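{- Let $h\colon[n]\to[n]$ be a Hessenberg function and let $w\in\mathfrak S_n$ be a generator for $h$. If $w$ avoids all of the associated patterns $[2143]_h$, $[1324]_h$, $[1243]_h$, $[2134]_h$, $[1423]_h$, $[2314]_h$, and $[2413]_h$, then the graph $\Gamma_{w,h}$ is regular.
   Context: A Hessenberg function is a nondecreasing $h\colon[n]\to[n]$ with $h(i)\ge i$. For $u\in\mathfrak S_n$ (one-line notation) and $i<j$, $u(i,j)$ is obtained from $u$ by swapping the entries in positions $i$ and $j$. The Bruhat order $\preceq$ is the reflexive–transitive closure of $u\prec u(i,j)$ when $u(i,j)$ has more inversions than $u$; $w_0=n(n-1)\cdots1$, $[w,w_0]=\{u\mid w\preceq u\preceq w_0\}$. A generator for $h$ is a $w$ with $w^{ -1}(w(i)+1)\le h(i)$ whenever $w(i)\le n-1$. $\Gamma_h$ is the graph with vertex set $\mathfrak S_n$ and edges $\{u,u(i,j)\}$ for $1\le i<j\le h(i)$; for a generator $w$, $\Gamma_{w,h}$ is the subgraph of $\Gamma_h$ induced on $[w,w_0]$. A graph is regular if all vertices have the same degree. $w$ avoids a pattern if it does not contain it. Associated patterns: $w$ contains $[2143]_h$ if $w(j)<w(i)<w(\ell)<w(k)$ for some $i<j<k<\ell\le h(i)$; $[1324]_h$ if $w(i)<w(k)<w(j)<w(\ell)$ for some $i<j<k<\ell\le h(j)$ with $k\le h(i)$; $[1243]_h$ if $w(i)<w(j)<w(\ell)<w(k)$ for some $i<j<k<\ell\le h(j)$ with $j\le h(i)<\ell$; $[2134]_h$ if $w(j)<w(i)<w(k)<w(\ell)$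 for some $i<j<k<\ell\le h(k)$ with $k\le h(i)<\ell$; $[1423]_h$ if $w(i)<w(k)<w(\ell)<w(j)$ for some $i<j<k<\ell\le h(j)$ with $k\le h(i)<\ell$; $[2314]_h$ if $w(k)<w(i)<w(j)<w(\ell)$ for some $i<j<k<\ell\le h(j)$ with $k\le h(i)<\ell$; $[2413]_h$ if $w(k)<w(i)<w(\ell)<w(j)$ for some $i<j\le h(i)<k\le h(j)<\ell\le h(k)$. -}

module Defs where

open import Data.Nat as ℕ using (ℕ; suc)
open import Data.Fin using (Fin; toℕ; opposite; _<_; _≤_)
open import Data.Fin.Properties using (_<?_)
open import Data.Vec using (Vec; lookup; tabulate; _[_]≔_)
open import Data.List using (List; length; filter; cartesianProduct)
import Data.List as List
open import Data.List.Relation.Unary.Unique.Propositional using (Unique)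
open import Data.List.Membership.Propositional using (_∈_)
open import Data.Product using (Σ; ∃; ∃-syntax; _×_; _,_; proj₁; proj₂)
open import Relation.Nullary.Decidable using (_×-dec_)
open import Relation.Binary.PropositionalEquality using (_≡_)
open import Function.Bundles using (_⇔_)
open import Level using (Level)

-- Conventions: [n] is modelled by Fin n (0-based: i ∈ Fin n stands for i+1),
-- a permutation of [n] in one-line notation is a Vec (Fin n) n whose
-- entries are pairwise distinct.

Perm : ℕ → Set
Perm n = Vec (Fin n) n

IsPermutation : ∀ {n} → Perm n → Set
IsPermutation {n} u = ∀ (i j : Fin n) → lookup u i ≡ lookup u j → i ≡ j

IsHessenberg : ∀ {n} → (Fin n → Fin n) → Set
IsHessenberg {n} h = (∀ (i j : Fin n) → i ≤ j → h i ≤ h j) × (∀ (i : Fin n) → i ≤ h i)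

swap : ∀ {n} → Perm n → Fin n → Fin n → Perm n
swap u i j = (u [ i ]≔ lookup u j) [ j ]≔ lookup u i

inv : ∀ {n} → Perm n → ℕ
inv {n} u = length (filter (λ p → (proj₁ p <? proj₂ p) ×-dec (lookup u (proj₂ p) <? lookup u (proj₁ p)))
                           (cartesianProduct (List.allFin n) (List.allFin n)))

-- Bruhat order: reflexive-transitive closure of u ≺ u(i,j) (i < j) when
-- u(i,j) has more inversions than u
data _⪯_ {n : ℕ} (u : Perm n) : Perm n → Set where
  ⪯-refl : u ⪯ u
  ⪯-step : ∀ {v} (i j : Fin n) → u ⪯ v → i < j → inv v ℕ.< inv (swap v i j) → u ⪯ swap v i j

w₀ : ∀ {n} → Perm n
w₀ {n} = tabulate opposite

InInterval : ∀ {n} → Perm n → Perm n → Set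
InInterval w u = w ⪯ u × u ⪯ w₀

-- generator for h: w⁻¹(w(i)+1) ≤ h(i) whenever w(i) ≤ n-1 (1-based);
-- i.e. the position p with w(p) = w(i)+1 satisfies p ≤ h(i)
IsGenerator : ∀ {n} → (Fin n → Fin n) → Perm n → Set
IsGenerator {n} h w = ∀ (i p : Fin n) → toℕ (lookup w p) ≡ suc (toℕ (lookup w i)) → p ≤ h i

Adjacent : ∀ {n} → (Fin n → Fin n) → Perm n → Perm n → Set
Adjacent {n} h u v = ∃[ i ] ∃[ j ] (i < j × j ≤ h i × v ≡ swap u i j)

HasSize : ∀ {a} {A : Set a} → (A → Set) → ℕ → Set a
HasSize {A = A} P d = Σ (List A) λ xs → length xs ≡ d × Unique xs × (∀ v → (v ∈ xs) ⇔ P v)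

-- neighbours of u in Γ_{w,h} (induced subgraph of Γ_h on [w, w₀])
NeighbourIn : ∀ {n} → (Fin n → Fin n) → Perm n → Perm n → Perm n → Set
NeighbourIn h w u v = InInterval w v × Adjacent h u v

IsRegular : ∀ {n} → (Fin n → Fin n) → Perm n → Set
IsRegular h w = ∃[ d ] (∀ u → InInterval w u → HasSize (NeighbourIn h w u) d)

module _ {n : ℕ} (h : Fin n → Fin n) (w : Perm n) where
  private
    W : Fin n → Fin n
    W = lookup w

  Contains2143 : Set
  Contains2143 = ∃[ i ] ∃[ j ] ∃[ k ] ∃[ ℓ ]
    (i < j × j < k × k < ℓ × ℓ ≤ h i × W j < W i × W i < W ℓ × W ℓ < W k)

  Contains1324 : Set
  Contains1324 = ∃[ i ] ∃[ j ] ∃[ k ] ∃[ ℓ ]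
    (i < j × j < k × k < ℓ × ℓ ≤ h j × k ≤ h i × W i < W k × W k < W j × W j < W ℓ)

  Contains1243 : Set
  Contains1243 = ∃[ i ] ∃[ j ] ∃[ k ] ∃[ ℓ ]
    (i < j × j < k × k < ℓ × ℓ ≤ h j × j ≤ h i × h i < ℓ × W i < W j × W j < W ℓ × W ℓ < W k)

  Contains2134 : Set
  Contains2134 = ∃[ i ] ∃[ j ] ∃[ k ] ∃[ ℓ ]
    (i < j × j < k × k < ℓ × ℓ ≤ h k × k ≤ h i × h i < ℓ × W j < W i × W i < W k × W k < W ℓ)

  Contains1423 : Set
  Contains1423 = ∃[ i ] ∃[ j ] ∃[ k ] ∃[ ℓ ]
    (i < j × j < k × k < ℓ × ℓ ≤ h j × k ≤ h i × h i < ℓ × W i < W k × W k < W ℓ × W ℓ < W j)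

  Contains2314 : Set
  Contains2314 = ∃[ i ] ∃[ j ] ∃[ k ] ∃[ ℓ ]
    (i < j × j < k × k < ℓ × ℓ ≤ h j × k ≤ h i × h i < ℓ × W k < W i × W i < W j × W j < W ℓ)

  Contains2413 : Set
  Contains2413 = ∃[ i ] ∃[ j ] ∃[ k ] ∃[ ℓ ]
    (i < j × j ≤ h i × h i < k × k ≤ h j × h j < ℓ × ℓ ≤ h k × W k < W i × W i < W ℓ × W ℓ < W j)

{-# OPTIONS --safe #-}
-- Let deg u be the number of edges (i , j) of h with w ⪯ u(i,j). In terms of the ranks
-- r_u(x , b) = #{k ≤ x : b ≤ u k}, the order w ⪯ u says r_w ≤ r_u, and for an inversion (i , j) of u
-- the swap u(i,j) leaves [w , w₀] exactly when the rectangle [i , j) × (u j , u i] contains a tight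
-- cell, i.e. one with r_w = r_u. If u p < u q, then v = u(p,q) has the tight cells of u outside the
-- rectangle of (p , q); comparing each pair of positions with its image under the transposition of
-- p and q gives deg u ≤ deg v, for every h and w. Hence deg w ≤ deg u ≤ deg w₀.
--
-- It remains to see deg w₀ ≤ deg w. An edge (i , j) is lost at u if u i is above all w l with l ≥ j,
-- or u j is below all w k with k ≤ i. Since w is a generator, one can climb from a value to any
-- larger one by unit steps in which every move to the right follows an edge;
-- together with the avoided patterns this shows that at w every inverted edge is above or below,
-- that w and w₀ have equally many edges above and equally many below, and that w has at least as
-- many edges as w₀ that are both. Inclusion-exclusion concludes.

module Submission where

open import Defs
open import Data.Bool using (if_then_else_)
open import Data.Empty using (⊥; ⊥-elim)
open import Data.Nat as ℕ using (ℕ; zero; suc; _+_; z≤n; s≤s)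
import Data.Nat.Properties as ℕₚ
open import Data.Fin using (Fin; zero; suc; toℕ; fromℕ<; opposite; punchOut; _<_; _≤_)
open import Data.Fin.Properties using (_≟_; _<?_; _≤?_; any?; all?; <-cmp; <⇒≢; ≤∧≢⇒<; punchOut-injective; injective⇒≤; opposite-prop; toℕ-fromℕ<; toℕ<n)
open import Data.Fin.Permutation using (permutation) renaming (transpose to transposition)
open import Data.Fin.Permutation.Components using (transpose)
open import Data.Vec using (lookup; _[_]≔_)
open import Data.Vec.Properties using (lookup∘update; lookup∘update′; lookup∘tabulate; tabulate∘lookup; tabulate-cong)
open import Data.List as List using (List; []; _∷_; length; filter; cartesianProduct)
open import Data.List.Properties using (length-++; length-map; filter-++; map-tabulate)
open import Data.List.Membership.Propositional using (_∈_)
open import Data.List.Membership.Propositional.Properties using (∈-map⁺; ∈-map⁻; ∈-filter⁺; ∈-filter⁻; ∈-cartesianProduct⁺; ∈-allFin)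
import Data.List.Relation.Unary.All as All
import Data.List.Relation.Unary.All.Properties as Allₚ
open import Data.List.Relation.Unary.AllPairs using ([]; _∷_)
open import Data.List.Relation.Unary.Any using (here; there)
open import Data.List.Relation.Unary.Unique.Propositional using (Unique)
open import Data.List.Relation.Unary.Unique.Propositional.Properties using (filter⁺; cartesianProduct⁺; allFin⁺)
open import Data.Product using (∃; _×_; _,_; proj₁; proj₂)
open import Data.Sum using (_⊎_; inj₁; inj₂) renaming (swap to ⊎-swap)
open import Data.Unit using (tt)
open import Data.Nat.Induction using (<-wellFounded; Acc; acc)
open import Function using (_∘_; id; mk⇔)
open import Relation.Binary using (Tri; tri<; tri≈; tri>)
open import Relation.Binary.PropositionalEquality using (_≡_; _≢_; refl; sym; trans; cong; cong₂; subst; subst₂)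
open import Relation.Nullary using (¬_; Dec; yes; no; does; contradiction)
open import Relation.Nullary.Decidable using (_×-dec_; _→-dec_; ¬?; decidable-stable)
open import Algebra.Properties.CommutativeSemigroup ℕₚ.+-commutativeSemigroup using (xy∙z≈xz∙y)
open import Algebra.Properties.CommutativeMonoid.Sum ℕₚ.+-0-commutativeMonoid using (sum; ∑-distrib-+; ∑-comm; sum-permute; sum-cong-≗)

private variable
  n : ℕ
  A B C D : Set

-- Finite sums and indicators

∑-mono-≤ : {f g : Fin n → ℕ} → (∀ i → f i ℕ.≤ g i) → sum f ℕ.≤ sum g
∑-mono-≤ {zero}  f≤g = z≤n
∑-mono-≤ {suc n} f≤g = ℕₚ.+-mono-≤ (f≤g zero) (∑-mono-≤ (f≤g ∘ suc))

∑-mono-< : {f g : Fin n → ℕ} → (∀ i → f i ℕ.≤ g i) → ∀ k → f k ℕ.< g k → sum f ℕ.< sum g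
∑-mono-< f≤g zero    fk<gk = ℕₚ.+-mono-<-≤ fk<gk (∑-mono-≤ (f≤g ∘ suc))
∑-mono-< f≤g (suc k) fk<gk = ℕₚ.+-mono-≤-< (f≤g zero) (∑-mono-< (f≤g ∘ suc) k fk<gk)

-- Both sides are cross sums because `ℕ` has no exact subtraction: the terms at `p` trade places and
-- all other terms agree.
∑-update : ∀ {f g : Fin n → ℕ} p → (∀ k → k ≢ p → f k ≡ g k) → sum f + g p ≡ sum g + f p
∑-update {f = f} {g} zero eq =
  trans (cong (λ s → (f zero + s) + g zero) (sum-cong-≗ (λ k → eq (suc k) (λ ()))))
        (trans (xy∙z≈xz∙y (f zero) _ (g zero))
               (trans (cong (_+ sum (g ∘ suc)) (ℕₚ.+-comm (f zero) (g zero))) (xy∙z≈xz∙y (g zero) (f zero) _)))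
∑-update {f = f} {g} (suc p) eq =
  trans (ℕₚ.+-assoc (f zero) _ _)
        (trans (cong₂ _+_ (eq zero (λ ())) (∑-update p (λ k k≢p → eq (suc k) λ { refl → k≢p refl })))
               (sym (ℕₚ.+-assoc (g zero) _ _)))

∑² : (Fin n → Fin n → ℕ) → ℕ
∑² f = sum λ i → sum (f i)

∑²-mono-≤ : {f g : Fin n → Fin n → ℕ} → (∀ i j → f i j ℕ.≤ g i j) → ∑² f ℕ.≤ ∑² g
∑²-mono-≤ f≤g = ∑-mono-≤ λ i → ∑-mono-≤ (f≤g i)

∑²-distrib-+ : (f g : Fin n → Fin n → ℕ) → ∑² (λ i j → f i j + g i j) ≡ ∑² f + ∑² g
∑²-distrib-+ f g = trans (sum-cong-≗ λ i → ∑-distrib-+ (f i) (g i)) (∑-distrib-+ (λ i → sum (f i)) (λ i → sum (g i)))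

𝟙 : Dec A → ℕ
𝟙 a? = if does a? then 1 else 0

𝟙-no : (a? : Dec A) → ¬ A → 𝟙 a? ≡ 0
𝟙-no (yes a) ¬a = contradiction a ¬a
𝟙-no (no _)  _  = refl

𝟙-yes : (a? : Dec A) → A → 𝟙 a? ≡ 1
𝟙-yes (yes _) _ = refl
𝟙-yes (no ¬a) a = contradiction a ¬a

𝟙-mono : (a? : Dec A) (b? : Dec B) → (A → B) → 𝟙 a? ℕ.≤ 𝟙 b?
𝟙-mono (yes _) (yes _) f = s≤s z≤n
𝟙-mono (yes a) (no ¬b) f = contradiction (f a) ¬b
𝟙-mono (no _)  b?      f = z≤n

-- The local form of every exchange argument below: an event may be lost at one place if it
-- reappears at the partner place, and when both places had it, both must keep it.
𝟙-exchange : (a? : Dec A) (b? : Dec B) (c? : Dec C) (d? : Dec D) →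
  (A → C ⊎ D) → (B → C ⊎ D) → (A → B → C × D) → 𝟙 a? + 𝟙 b? ℕ.≤ 𝟙 c? + 𝟙 d?
𝟙-exchange (no _)  (no _)  _       _       _ _ _ = z≤n
𝟙-exchange (no _)  (yes _) (yes _) _       _ _ _ = s≤s z≤n
𝟙-exchange (no _)  (yes _) (no _)  (yes _) _ _ _ = s≤s z≤n
𝟙-exchange (yes _) (no _)  (yes _) _       _ _ _ = s≤s z≤n
𝟙-exchange (yes _) (no _)  (no _)  (yes _) _ _ _ = s≤s z≤n
𝟙-exchange (yes _) (yes _) (yes _) (yes _) _ _ _ = ℕₚ.≤-refl
𝟙-exchange (no _)  (yes b) (no ¬c) (no ¬d) _ g _ with g b
... | inj₁ c = contradiction c ¬c
... | inj₂ d = contradiction d ¬d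
𝟙-exchange (yes a) (no _)  (no ¬c) (no ¬d) f _ _ with f a
... | inj₁ c = contradiction c ¬c
... | inj₂ d = contradiction d ¬d
𝟙-exchange (yes a) (yes b) (no ¬c) _       _ _ k = contradiction (proj₁ (k a b)) ¬c
𝟙-exchange (yes a) (yes b) (yes _) (no ¬d) _ _ k = contradiction (proj₂ (k a b)) ¬d

double-cancel-≤ : ∀ {a b} → a + a ℕ.≤ b + b → a ℕ.≤ b
double-cancel-≤ {a} {b} le with a ℕₚ.≤? b
... | yes a≤b = a≤b
... | no  a≰b = contradiction le (ℕₚ.<⇒≱ (ℕₚ.+-mono-< (ℕₚ.≰⇒> a≰b) (ℕₚ.≰⇒> a≰b)))

double-cancel-< : ∀ {a b} → a + a ℕ.< b + b → a ℕ.< b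
double-cancel-< {a} {b} lt with b ℕₚ.≤? a
... | yes b≤a = contradiction (ℕₚ.+-mono-≤ b≤a b≤a) (ℕₚ.<⇒≱ lt)
... | no  b≰a = ℕₚ.≰⇒> b≰a

∑²-transpose : ∀ (p q : Fin n) (f : Fin n → Fin n → ℕ) →
  ∑² (λ i j → f i j + f (transpose p q i) (transpose p q j)) ≡ ∑² f + ∑² f
∑²-transpose p q f = trans (∑²-distrib-+ f (λ i j → f (transpose p q i) (transpose p q j))) (cong (∑² f +_) (sym
  (trans (sum-permute (λ i → sum (f i)) (transposition p q))
         (sum-cong-≗ λ i → sum-permute (f (transpose p q i)) (transposition p q)))))

-- Each pair of positions is added to its image under the transposition. Every pair is then counted
-- twice, fixed ones included, so no orbit representatives have to be chosen and a factor 2 is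
-- cancelled at the end.
exchange-≤ : ∀ (p q : Fin n) (f g : Fin n → Fin n → ℕ) →
  (∀ i j → f i j + f (transpose p q i) (transpose p q j) ℕ.≤ g i j + g (transpose p q i) (transpose p q j)) →
  ∑² f ℕ.≤ ∑² g
exchange-≤ p q f g le = double-cancel-≤
  (subst₂ ℕ._≤_ (∑²-transpose p q f) (∑²-transpose p q g) (∑²-mono-≤ le))

exchange-< : ∀ (p q : Fin n) (f g : Fin n → Fin n → ℕ) →
  (∀ i j → f i j + f (transpose p q i) (transpose p q j) ℕ.≤ g i j + g (transpose p q i) (transpose p q j)) →
  f p q + f (transpose p q p) (transpose p q q) ℕ.< g p q + g (transpose p q p) (transpose p q q) →
  ∑² f ℕ.< ∑² g
exchange-< p q f g le lt = double-cancel-<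
  (subst₂ ℕ._<_ (∑²-transpose p q f) (∑²-transpose p q g)
    (∑-mono-< (λ i → ∑-mono-≤ (le i)) p (∑-mono-< (le p) q lt)))

length-filter-tabulate : {P : A → Set} (P? : ∀ a → Dec (P a)) (f : Fin n → A) →
  length (filter P? (List.tabulate f)) ≡ sum λ i → 𝟙 (P? (f i))
length-filter-tabulate {n = zero}  P? f = refl
length-filter-tabulate {n = suc n} P? f with P? (f zero)
... | yes _ = cong suc (length-filter-tabulate P? (f ∘ suc))
... | no  _ = length-filter-tabulate P? (f ∘ suc)

length-filter-cartesianProduct : ∀ {m} {P : A × B → Set} (P? : ∀ a → Dec (P a)) (f : Fin m → A) (g : Fin n → B) →
  length (filter P? (cartesianProduct (List.tabulate f) (List.tabulate g)))
    ≡ sum λ i → sum λ j → 𝟙 (P? (f i , g j))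
length-filter-cartesianProduct {m = zero}  P? f g = refl
length-filter-cartesianProduct {m = suc m} P? f g =
  trans (cong length (filter-++ P? (List.map (f zero ,_) (List.tabulate g)) _))
  (trans (length-++ (filter P? (List.map (f zero ,_) (List.tabulate g))))
  (cong₂ _+_ (trans (cong (length ∘ filter P?) (map-tabulate g (f zero ,_))) (length-filter-tabulate P? ((f zero ,_) ∘ g)))
             (length-filter-cartesianProduct P? (f ∘ suc) g)))

least : {P : Fin n → Set} → (∀ i → Dec (P i)) → ∃ P → ∃ λ i → P i × (∀ k → k < i → ¬ P k)
least {suc n} P? (i , Pi) with P? zero
... | yes P0 = zero , P0 , λ _ ()
least {suc n} P? (zero  , P0) | no ¬P0 = contradiction P0 ¬P0
least {suc n} P? (suc i , Pi) | no ¬P0 with least (P? ∘ suc) (i , Pi)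
... | j , Pj , below = suc j , Pj , λ { zero _ → ¬P0 ; (suc k) (s≤s k<j) → below k k<j }

-- Permutations, inversions and ranks

infix 9 _‼_
_‼_ : Perm n → Fin n → Fin n
u ‼ i = lookup u i

-- Pigeonhole: if `v` were missed, punching it out would give an injection from `Fin (suc n)` into
-- `Fin n`.
position : (u : Perm n) → IsPermutation u → ∀ v → ∃ λ i → u ‼ i ≡ v
position {suc n} u inj v with any? (λ i → u ‼ i ≟ v)
... | yes hit = hit
... | no miss = contradiction (injective⇒≤ {f = λ i → punchOut (v≢ i)} λ {i} {j} eq → inj i j (punchOut-injective (v≢ i) (v≢ j) eq)) ℕₚ.1+n≰n
  where
  v≢ : ∀ i → v ≢ u ‼ i
  v≢ i eq = miss (i , sym eq)

∑-perm : (u : Perm n) → IsPermutation u → (f : Fin n → ℕ) → sum (λ i → f (u ‼ i)) ≡ sum f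
∑-perm u inj f = sym (sum-permute f (permutation (u ‼_) (proj₁ ∘ position u inj) (proj₂ ∘ position u inj)
  (λ i → inj _ i (proj₂ (position u inj (u ‼ i))))))

-- The graph of `transpose p q` as a data type. Matching on it carries out the case distinction on
-- `p` and `q` and the rewriting of the image in one go.
data Transposed {n} (p q : Fin n) : Fin n → Fin n → Set where
  at-p : Transposed p q p q
  at-q : Transposed p q q p
  off  : ∀ {k} → k ≢ p → k ≢ q → Transposed p q k k

transposed : ∀ (p q k : Fin n) → Transposed p q k (transpose p q k)
transposed p q k with k ≟ p
... | yes refl = at-p
... | no k≢p with k ≟ q
...   | yes refl = at-q
...   | no k≢q = off k≢p k≢q

module _ (u : Perm n) {p q : Fin n} (p<q : p < q) where

  swap-fst : swap u p q ‼ p ≡ u ‼ q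
  swap-fst = trans (lookup∘update′ (<⇒≢ p<q) (u [ p ]≔ u ‼ q) (u ‼ p)) (lookup∘update p u (u ‼ q))

  swap-snd : swap u p q ‼ q ≡ u ‼ p
  swap-snd = lookup∘update q (u [ p ]≔ u ‼ q) (u ‼ p)

  swap-off : ∀ {k} → k ≢ p → k ≢ q → swap u p q ‼ k ≡ u ‼ k
  swap-off k≢p k≢q = trans (lookup∘update′ k≢q (u [ p ]≔ u ‼ q) (u ‼ p)) (lookup∘update′ k≢p u (u ‼ q))

  lookup-swap : ∀ {k k′} → Transposed p q k k′ → swap u p q ‼ k ≡ u ‼ k′
  lookup-swap at-p            = swap-fst
  lookup-swap at-q            = swap-snd
  lookup-swap (off k≢p k≢q) = swap-off k≢p k≢q

ext : {u v : Perm n} → (∀ i → u ‼ i ≡ v ‼ i) → u ≡ v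
ext {u = u} {v} eq = trans (sym (tabulate∘lookup u)) (trans (tabulate-cong eq) (tabulate∘lookup v))

Transposed-sym : ∀ {p q k k′ : Fin n} → Transposed p q k k′ → Transposed p q k′ k
Transposed-sym at-p            = at-q
Transposed-sym at-q            = at-p
Transposed-sym (off k≢p k≢q) = off k≢p k≢q

swap-involutive : (u : Perm n) {p q : Fin n} → p < q → swap (swap u p q) p q ≡ u
swap-involutive u {p} {q} p<q = ext λ k → trans (lookup-swap (swap u p q) p<q (transposed p q k))
  (lookup-swap u p<q (Transposed-sym (transposed p q k)))

swap-isPermutation : (u : Perm n) {p q : Fin n} → p < q → IsPermutation u → IsPermutation (swap u p q)
swap-isPermutation u {p} {q} p<q inj i j eq = unique (transposed p q i) (transposed p q j)
  (inj _ _ (trans (sym (lookup-swap u p<q (transposed p q i))) (trans eq (lookup-swap u p<q (transposed p q j)))))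
  where
  unique : ∀ {k l m o} → Transposed p q k m → Transposed p q l o → m ≡ o → k ≡ l
  unique at-p at-p _ = refl
  unique at-p at-q q≡p = sym q≡p
  unique at-p (off _ l≢q) q≡l = contradiction (sym q≡l) l≢q
  unique at-q at-p p≡q = sym p≡q
  unique at-q at-q _ = refl
  unique at-q (off l≢p _) p≡l = contradiction (sym p≡l) l≢p
  unique (off _ k≢q) at-p k≡q = contradiction k≡q k≢q
  unique (off k≢p _) at-q k≡p = contradiction k≡p k≢p
  unique (off _ _) (off _ _) k≡l = k≡l

inversion? : (u : Perm n) (i j : Fin n) → Dec (i < j × u ‼ j < u ‼ i)
inversion? u i j = (i <? j) ×-dec (u ‼ j <? u ‼ i)

inv-∑ : (u : Perm n) → inv u ≡ ∑² λ i j → 𝟙 (inversion? u i j)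
inv-∑ u = length-filter-cartesianProduct (λ p → inversion? u (proj₁ p) (proj₂ p)) id id

-- No orbit of the transposition of `p` and `q` loses inversions, and the orbit of `(p , q)` gains
-- one.
inv-swap : (u : Perm n) {p q : Fin n} → p < q → u ‼ p < u ‼ q → inv u ℕ.< inv (swap u p q)
inv-swap u {p} {q} p<q up<uq = subst₂ ℕ._<_ (sym (inv-∑ u)) (sym (inv-∑ v))
  (exchange-< p q _ _ (λ i j → le (transposed p q i) (transposed p q j)) strict)
  where
  v = swap u p q

  inv-v : ∀ {i i′ j j′} → Transposed p q i i′ → Transposed p q j j′ → i < j → u ‼ j′ < u ‼ i′ → i < j × v ‼ j < v ‼ i
  inv-v ti tj i<j lt = i<j , subst₂ _<_ (sym (lookup-swap u p<q tj)) (sym (lookup-swap u p<q ti)) lt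

  -- Either the positions `i`, `j` are still inverted after the swap, or the two entries are still
  -- inverted at their new positions.
  moved : ∀ {i i′ j j′} → Transposed p q i i′ → Transposed p q j j′ → i < j → u ‼ j < u ‼ i →
          (i < j × u ‼ j′ < u ‼ i′) ⊎ (i′ < j′ × u ‼ j < u ‼ i)
  moved at-p      at-p      p<p _  = contradiction p<p (ℕₚ.<-irrefl refl)
  moved at-p      at-q      _   lt = contradiction lt (ℕₚ.<-asym up<uq)
  moved at-p      (off _ _) p<k lt = inj₁ (p<k , ℕₚ.<-trans lt up<uq)
  moved at-q      at-p      q<p _  = contradiction q<p (ℕₚ.<-asym p<q)
  moved at-q      at-q      q<q _  = contradiction q<q (ℕₚ.<-irrefl refl)
  moved at-q      (off _ _) q<k lt = inj₂ (ℕₚ.<-trans p<q q<k , lt)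
  moved (off _ _) at-p      k<p lt = inj₂ (ℕₚ.<-trans k<p p<q , lt)
  moved (off _ _) at-q      k<q lt = inj₁ (k<q , ℕₚ.<-trans up<uq lt)
  moved (off _ _) (off _ _) k<l lt = inj₁ (k<l , lt)

  either : ∀ {i i′ j j′} → Transposed p q i i′ → Transposed p q j j′ → i < j × u ‼ j < u ‼ i →
           (i < j × v ‼ j < v ‼ i) ⊎ (i′ < j′ × v ‼ j′ < v ‼ i′)
  either ti tj (i<j , lt) with moved ti tj i<j lt
  ... | inj₁ (a , b) = inj₁ (inv-v ti tj a b)
  ... | inj₂ (a , b) = inj₂ (inv-v (Transposed-sym ti) (Transposed-sym tj) a b)

  le : ∀ {i i′ j j′} → Transposed p q i i′ → Transposed p q j j′ →
       𝟙 (inversion? u i j) + 𝟙 (inversion? u i′ j′) ℕ.≤ 𝟙 (inversion? v i j) + 𝟙 (inversion? v i′ j′)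
  le {i} {i′} {j} {j′} ti tj = 𝟙-exchange (inversion? u i j) (inversion? u i′ j′) (inversion? v i j) (inversion? v i′ j′)
    (either ti tj)
    (⊎-swap ∘ either (Transposed-sym ti) (Transposed-sym tj))
    λ (i<j , lt) (i′<j′ , lt′) → inv-v ti tj i<j lt′ , inv-v (Transposed-sym ti) (Transposed-sym tj) i′<j′ lt

  reversed : ∀ {p′ q′} → Transposed p q p p′ → Transposed p q q q′ → ¬ p′ < q′
  reversed at-p         at-p         q<q = ℕₚ.<-irrefl refl q<q
  reversed at-p         at-q         q<p = ℕₚ.<-asym p<q q<p
  reversed at-p         (off _ q≢q) _   = q≢q refl
  reversed at-q         _            _   = ℕₚ.<-irrefl refl p<q
  reversed (off p≢p _) _            _   = p≢p refl

  strict : 𝟙 (inversion? u p q) + 𝟙 (inversion? u (transpose p q p) (transpose p q q))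
             ℕ.< 𝟙 (inversion? v p q) + 𝟙 (inversion? v (transpose p q p) (transpose p q q))
  strict
    rewrite 𝟙-no (inversion? u p q) (λ (_ , lt) → ℕₚ.<-asym up<uq lt)
          | 𝟙-no (inversion? u (transpose p q p) (transpose p q q)) (reversed (transposed p q p) (transposed p q q) ∘ proj₁)
          | 𝟙-yes (inversion? v p q) (inv-v at-p at-q p<q up<uq) = s≤s z≤n

-- With equal entries the swap changes nothing; with a descent, `u` is itself the swap of an ascent
-- and has more inversions by `inv-swap`.
inv-swap⁻¹ : (u : Perm n) {p q : Fin n} → p < q → inv u ℕ.< inv (swap u p q) → u ‼ p < u ‼ q
inv-swap⁻¹ u {p} {q} p<q lt with <-cmp (u ‼ p) (u ‼ q)
... | tri< up<uq _ _ = up<uq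
... | tri≈ _ up≡uq _ = contradiction (cong inv {x = swap u p q} {y = u} (ext λ k → trans (lookup-swap u p<q (transposed p q k)) (same (transposed p q k)))) (ℕₚ.<⇒≢ lt ∘ sym)
  where
  same : ∀ {k k′} → Transposed p q k k′ → u ‼ k′ ≡ u ‼ k
  same at-p      = sym up≡uq
  same at-q      = up≡uq
  same (off _ _) = refl
... | tri> _ _ uq<up = contradiction lt (ℕₚ.<-asym (subst (λ x → inv (swap u p q) ℕ.< inv x) (swap-involutive u p<q)
  (inv-swap (swap u p q) p<q (subst₂ _<_ (sym (swap-fst u p<q)) (sym (swap-snd u p<q)) uq<up))))

-- Ranks and their change under a swap

balance-≤ : ∀ {a c x y} → a + y ≡ c + x → x ℕ.≤ y → a ℕ.≤ c
balance-≤ {a} {c} {x} {y} eq x≤y = ℕₚ.+-cancelʳ-≤ y a c (ℕₚ.≤-trans (ℕₚ.≤-reflexive eq) (ℕₚ.+-monoʳ-≤ c x≤y))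

balance-< : ∀ {a c x y} → a + y ≡ c + x → x ℕ.< y → a ℕ.< c
balance-< {a} {c} {x} {y} eq x<y = ℕₚ.+-cancelʳ-< y a c (ℕₚ.≤-<-trans (ℕₚ.≤-reflexive eq) (ℕₚ.+-monoʳ-< c x<y))

cell : (x b k v : Fin n) → ℕ
cell x b k v = 𝟙 ((k ≤? x) ×-dec (b ≤? v))

rank : Perm n → Fin n → Fin n → ℕ
rank u x b = sum λ k → cell x b k (u ‼ k)

rank-update : ∀ (u : Perm n) i c x b → rank (u [ i ]≔ c) x b + cell x b i (u ‼ i) ≡ rank u x b + cell x b i c
rank-update u i c x b = trans
  (∑-update i (λ k k≢i → cong (cell x b k) (lookup∘update′ k≢i u c)))
  (cong (λ z → rank u x b + cell x b i z) (lookup∘update i u c))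

module _ (u : Perm n) {i j : Fin n} (i<j : i < j) where

  -- A swap is two successive updates; lost and gained cells stand on opposite sides of the
  -- equation, again to avoid subtraction.
  rank-swap : ∀ x b → rank (swap u i j) x b + (cell x b j (u ‼ j) + cell x b i (u ‼ i))
                    ≡ rank u x b + (cell x b i (u ‼ j) + cell x b j (u ‼ i))
  rank-swap x b =
    trans (sym (ℕₚ.+-assoc (rank (swap u i j) x b) _ _))
    (trans (cong (λ z → rank (swap u i j) x b + cell x b j z + cell x b i (u ‼ i)) (sym (lookup∘update′ (<⇒≢ i<j ∘ sym) u (u ‼ j))))
    (trans (cong (_+ cell x b i (u ‼ i)) (rank-update (u [ i ]≔ u ‼ j) j (u ‼ i) x b))
    (trans (xy∙z≈xz∙y (rank (u [ i ]≔ u ‼ j) x b) _ _)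
    (trans (cong (_+ cell x b j (u ‼ i)) (rank-update u i (u ‼ j) x b))
    (ℕₚ.+-assoc (rank u x b) _ _)))))

  rank-swap-drop : ∀ {x b} → i ≤ x → x < j → u ‼ j < b → b ≤ u ‼ i → rank (swap u i j) x b ℕ.< rank u x b
  rank-swap-drop {x} {b} i≤x x<j uj<b b≤ui = balance-< (rank-swap x b) lt
    where
    lt : cell x b i (u ‼ j) + cell x b j (u ‼ i) ℕ.< cell x b j (u ‼ j) + cell x b i (u ‼ i)
    lt rewrite 𝟙-no ((i ≤? x) ×-dec (b ≤? u ‼ j)) (λ (_ , b≤uj) → ℕₚ.<⇒≱ uj<b b≤uj)
             | 𝟙-no ((j ≤? x) ×-dec (b ≤? u ‼ i)) (λ (j≤x , _) → ℕₚ.<⇒≱ x<j j≤x)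
             | 𝟙-yes ((i ≤? x) ×-dec (b ≤? u ‼ i)) (i≤x , b≤ui) = ℕₚ.m≤n+m 1 _

  rank-swap-rise : ∀ {x b} → i ≤ x → x < j → u ‼ i < b → b ≤ u ‼ j → rank u x b ℕ.< rank (swap u i j) x b
  rank-swap-rise {x} {b} i≤x x<j ui<b b≤uj = balance-< (sym (rank-swap x b)) lt
    where
    lt : cell x b j (u ‼ j) + cell x b i (u ‼ i) ℕ.< cell x b i (u ‼ j) + cell x b j (u ‼ i)
    lt rewrite 𝟙-no ((i ≤? x) ×-dec (b ≤? u ‼ i)) (λ (_ , b≤ui) → ℕₚ.<⇒≱ ui<b b≤ui)
             | 𝟙-no ((j ≤? x) ×-dec (b ≤? u ‼ j)) (λ (j≤x , _) → ℕₚ.<⇒≱ x<j j≤x)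
             | 𝟙-yes ((i ≤? x) ×-dec (b ≤? u ‼ j)) (i≤x , b≤uj) = s≤s z≤n

  -- For `x < i` neither position counts and for `j ≤ x` both do, so the rank can fall only in the
  -- rows between; `keep` rules that out.
  rank-swap-≤ : ∀ {x b} → (i ≤ x → x < j → b ≤ u ‼ i → b ≤ u ‼ j) → rank u x b ℕ.≤ rank (swap u i j) x b
  rank-swap-≤ {x} {b} keep = balance-≤ (sym (rank-swap x b)) (𝟙-exchange
    ((j ≤? x) ×-dec (b ≤? u ‼ j)) ((i ≤? x) ×-dec (b ≤? u ‼ i))
    ((i ≤? x) ×-dec (b ≤? u ‼ j)) ((j ≤? x) ×-dec (b ≤? u ‼ i))
    (λ (j≤x , b≤uj) → inj₁ (ℕₚ.<⇒≤ (ℕₚ.<-≤-trans i<j j≤x) , b≤uj))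
    outer
    λ (j≤x , b≤uj) (i≤x , b≤ui) → (i≤x , b≤uj) , (j≤x , b≤ui))
    where
    outer : i ≤ x × b ≤ u ‼ i → (i ≤ x × b ≤ u ‼ j) ⊎ (j ≤ x × b ≤ u ‼ i)
    outer (i≤x , b≤ui) with j ≤? x
    ... | yes j≤x = inj₂ (j≤x , b≤ui)
    ... | no  j≰x = inj₁ (i≤x , keep i≤x (ℕₚ.≰⇒> j≰x) b≤ui)

  -- Position `j` does not count yet, so at most the contribution of position `i` is lost.
  rank-swap-pred : ∀ {x b} → x < j → rank u x b ℕ.≤ suc (rank (swap u i j) x b)
  rank-swap-pred {x} {b} x<j = ℕₚ.≤-trans (ℕₚ.m≤m+n (rank u x b) _) (ℕₚ.≤-trans (ℕₚ.≤-reflexive (sym (rank-swap x b)))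
    (ℕₚ.≤-trans (ℕₚ.+-monoʳ-≤ (rank (swap u i j) x b) le) (ℕₚ.≤-reflexive (ℕₚ.+-comm _ 1))))
    where
    le : cell x b j (u ‼ j) + cell x b i (u ‼ i) ℕ.≤ 1
    le rewrite 𝟙-no ((j ≤? x) ×-dec (b ≤? u ‼ j)) (λ (j≤x , _) → ℕₚ.<⇒≱ x<j j≤x) =
      𝟙-mono ((i ≤? x) ×-dec (b ≤? u ‼ i)) (yes tt) (λ _ → tt)

-- The rank criterion for the Bruhat order

_⊑_ : Perm n → Perm n → Set
w ⊑ u = ∀ x b → rank w x b ℕ.≤ rank u x b

-- Decidability of the rank criterion is what allows neighbours to be counted by indicators.
_⊑?_ : (w u : Perm n) → Dec (w ⊑ u)
w ⊑? u = all? λ x → all? λ b → rank w x b ℕₚ.≤? rank u x b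

ascent-⊑ : (u : Perm n) {p q : Fin n} → p < q → u ‼ p < u ‼ q → u ⊑ swap u p q
ascent-⊑ u p<q up<uq x b = rank-swap-≤ u p<q {x} {b} λ _ _ b≤up → ℕₚ.<⇒≤ (ℕₚ.≤-<-trans b≤up up<uq)

⪯⇒⊑ : {w u : Perm n} → w ⪯ u → w ⊑ u
⪯⇒⊑ ⪯-refl x b = ℕₚ.≤-refl
⪯⇒⊑ (⪯-step {v} i j w⪯v i<j lt) x b = ℕₚ.≤-trans (⪯⇒⊑ w⪯v x b) (ascent-⊑ v i<j (inv-swap⁻¹ v i<j lt) x b)

⪯-isPermutation : {w u : Perm n} → IsPermutation w → w ⪯ u → IsPermutation u
⪯-isPermutation perm ⪯-refl = perm
⪯-isPermutation perm (⪯-step {v} i j w⪯v i<j _) = swap-isPermutation v i<j (⪯-isPermutation perm w⪯v)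

module _ (w u : Perm n) where

  -- No cell of the rectangle of an inversion (i , j) of u is tight; vacuous if (i , j) is not an inversion.
  Loose : Fin n → Fin n → Set
  Loose i j = ∀ x b → i ≤ x → x < j → u ‼ j < b → b ≤ u ‼ i → rank w x b ℕ.< rank u x b

  swap-⊑⇒Loose : ∀ {i j} → i < j → w ⊑ swap u i j → Loose i j
  swap-⊑⇒Loose i<j w⊑ x b i≤x x<j uj<b b≤ui = ℕₚ.≤-<-trans (w⊑ x b) (rank-swap-drop u i<j i≤x x<j uj<b b≤ui)

  -- Inside the rectangle a swap loses at most one, which looseness leaves to spare; outside it
  -- loses nothing.
  Loose⇒swap-⊑ : ∀ {i j} → i < j → w ⊑ u → Loose i j → w ⊑ swap u i j
  Loose⇒swap-⊑ {i} {j} i<j w⊑u loose x b with (i ≤? x) ×-dec (x <? j) ×-dec (u ‼ j <? b) ×-dec (b ≤? u ‼ i)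
  ... | yes (i≤x , x<j , uj<b , b≤ui) =
    ℕ.s≤s⁻¹ (ℕₚ.≤-trans (loose x b i≤x x<j uj<b b≤ui) (rank-swap-pred u i<j {x} {b} x<j))
  ... | no outside = ℕₚ.≤-trans (w⊑u x b) (rank-swap-≤ u i<j {x} {b} λ i≤x x<j b≤ui →
    ℕₚ.≮⇒≥ λ uj<b → outside (i≤x , x<j , uj<b , b≤ui))

-- One downward step for `⊑⇒⪯`: at the first position `i` where `w` and `u` differ, `u ‼ i` is
-- exchanged with the first later entry that is at least `w ‼ i` and below `u ‼ i`.
module Descend (w u : Perm n) (w-perm : IsPermutation w) (u-perm : IsPermutation u) (w⊑u : w ⊑ u)
  {i : Fin n} (wi≢ui : w ‼ i ≢ u ‼ i) (agree : ∀ k → k < i → w ‼ k ≡ u ‼ k) where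

  -- If `u ‼ i` were smaller, row `i` at height `w ‼ i` would count one position more for `w` than
  -- for `u`.
  wi<ui : w ‼ i < u ‼ i
  wi<ui with <-cmp (w ‼ i) (u ‼ i)
  ... | tri< lt _ _ = lt
  ... | tri≈ _ eq _ = contradiction eq wi≢ui
  ... | tri> _ _ ui<wi = contradiction (w⊑u i (w ‼ i)) (ℕₚ.<⇒≱ (∑-mono-< le i lt))
    where
    lt : cell i (w ‼ i) i (u ‼ i) ℕ.< cell i (w ‼ i) i (w ‼ i)
    lt rewrite 𝟙-no ((i ≤? i) ×-dec (w ‼ i ≤? u ‼ i)) (λ (_ , wi≤ui) → ℕₚ.<⇒≱ ui<wi wi≤ui)
             | 𝟙-yes ((i ≤? i) ×-dec (w ‼ i ≤? w ‼ i)) (ℕₚ.≤-refl , ℕₚ.≤-refl) = s≤s z≤n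

    le : ∀ k → cell i (w ‼ i) k (u ‼ k) ℕ.≤ cell i (w ‼ i) k (w ‼ k)
    le k with <-cmp k i
    ... | tri< k<i _ _ = ℕₚ.≤-reflexive (cong (cell i (w ‼ i) k) (sym (agree k k<i)))
    ... | tri≈ _ refl _ = ℕₚ.<⇒≤ lt
    ... | tri> _ _ i<k = 𝟙-mono ((k ≤? i) ×-dec (w ‼ i ≤? u ‼ k)) ((k ≤? i) ×-dec (w ‼ i ≤? w ‼ k))
      (λ (k≤i , _) → contradiction k≤i (ℕₚ.<⇒≱ i<k))

  Candidate : Fin n → Set
  Candidate j = i < j × w ‼ i ≤ u ‼ j × u ‼ j < u ‼ i

  -- The value `w ‼ i` itself occurs in `u` after position `i`, since the earlier entries of `u` are
  -- those of `w`.
  candidate : ∃ Candidate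
  candidate with position u u-perm (w ‼ i)
  ... | j , uj≡wi with <-cmp i j
  ...   | tri< i<j _ _ = j , i<j , ℕₚ.≤-reflexive (cong toℕ (sym uj≡wi)) , subst (_< u ‼ i) (sym uj≡wi) wi<ui
  ...   | tri≈ _ refl _ = contradiction (sym uj≡wi) wi≢ui
  ...   | tri> _ _ j<i = contradiction (w-perm j i (trans (agree j j<i) uj≡wi)) (<⇒≢ j<i)

  -- Up to x < j, the values of u in [w i , b) lie before position i, where w has the same ones;
  -- w has the additional value w i, so the rank inequality at w i is strict at b.
  loose : ∀ {j} → Candidate j → (∀ k → k < j → ¬ Candidate k) → Loose w u i j
  loose {j} (i<j , wi≤uj , uj<ui) first x b i≤x x<j uj<b b≤ui =
    ℕₚ.+-cancelʳ-< (rank u x c) (rank w x b) (rank u x b)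
      (ℕₚ.<-≤-trans strict (ℕₚ.+-monoʳ-≤ (rank u x b) (w⊑u x c)))
    where
    c = w ‼ i

    c<b : c < b
    c<b = ℕₚ.≤-<-trans wi≤uj uj<b

    lt : cell x b i (w ‼ i) + cell x c i (u ‼ i) ℕ.< cell x b i (u ‼ i) + cell x c i (w ‼ i)
    lt rewrite 𝟙-no ((i ≤? x) ×-dec (b ≤? w ‼ i)) (λ (_ , b≤c) → ℕₚ.<⇒≱ c<b b≤c)
             | 𝟙-yes ((i ≤? x) ×-dec (c ≤? u ‼ i)) (i≤x , ℕₚ.<⇒≤ wi<ui)
             | 𝟙-yes ((i ≤? x) ×-dec (b ≤? u ‼ i)) (i≤x , b≤ui)
             | 𝟙-yes ((i ≤? x) ×-dec (c ≤? w ‼ i)) (i≤x , ℕₚ.≤-refl) = ℕₚ.≤-refl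

    le : ∀ k → cell x b k (w ‼ k) + cell x c k (u ‼ k) ℕ.≤ cell x b k (u ‼ k) + cell x c k (w ‼ k)
    le k with <-cmp k i
    ... | tri< k<i _ _ rewrite agree k k<i = ℕₚ.≤-refl
    ... | tri≈ _ refl _ = ℕₚ.<⇒≤ lt
    ... | tri> _ _ i<k = 𝟙-exchange
      ((k ≤? x) ×-dec (b ≤? w ‼ k)) ((k ≤? x) ×-dec (c ≤? u ‼ k))
      ((k ≤? x) ×-dec (b ≤? u ‼ k)) ((k ≤? x) ×-dec (c ≤? w ‼ k))
      (λ (k≤x , b≤wk) → inj₂ (k≤x , ℕₚ.<⇒≤ (ℕₚ.<-≤-trans c<b b≤wk)))
      (λ (k≤x , c≤uk) → inj₁ (k≤x , high k≤x c≤uk))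
      (λ (k≤x , b≤wk) (_ , c≤uk) → (k≤x , high k≤x c≤uk) , (k≤x , ℕₚ.<⇒≤ (ℕₚ.<-≤-trans c<b b≤wk)))
      where
      high : k ≤ x → c ≤ u ‼ k → b ≤ u ‼ k
      high k≤x c≤uk = ℕₚ.≤-trans b≤ui (ℕₚ.≮⇒≥ λ uk<ui → first k (ℕₚ.≤-<-trans k≤x x<j) (i<k , c≤uk , uk<ui))

    strict : rank w x b + rank u x c ℕ.< rank u x b + rank w x c
    strict = subst₂ ℕ._<_ (∑-distrib-+ (λ k → cell x b k (w ‼ k)) (λ k → cell x c k (u ‼ k)))
                          (∑-distrib-+ (λ k → cell x b k (u ‼ k)) (λ k → cell x c k (w ‼ k)))
                          (∑-mono-< le i lt)

-- Well-founded induction on the number of inversions of `u`: `Descend` undoes one swap at a time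
-- until `w` is reached.
⊑⇒⪯ : {w u : Perm n} → IsPermutation w → IsPermutation u → w ⊑ u → w ⪯ u
⊑⇒⪯ {n} {w} w-perm = λ u-perm w⊑u → go _ (<-wellFounded _) refl u-perm w⊑u
  where
  go : ∀ m → Acc ℕ._<_ m → ∀ {u} → inv u ≡ m → IsPermutation u → w ⊑ u → w ⪯ u
  go m (acc rec) {u} refl u-perm w⊑u with any? (λ i → ¬? (w ‼ i ≟ u ‼ i))
  ... | no  same = subst (w ⪯_) (ext λ i → decidable-stable (w ‼ i ≟ u ‼ i) (λ ne → same (i , ne))) ⪯-refl
  ... | yes differ with least (λ i → ¬? (w ‼ i ≟ u ‼ i)) differ
  ...   | i , wi≢ui , before = step
    where
    open Descend w u w-perm u-perm w⊑u wi≢ui (λ k k<i → decidable-stable (w ‼ k ≟ u ‼ k) (before k k<i))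

    step : w ⪯ u
    step with least (λ j → (i <? j) ×-dec (w ‼ i ≤? u ‼ j) ×-dec (u ‼ j <? u ‼ i)) candidate
    ... | j , cj@(i<j , _ , uj<ui) , first = subst (w ⪯_) back (⪯-step i j
        (go (inv v) (rec lower) refl (swap-isPermutation u i<j u-perm) (Loose⇒swap-⊑ w u i<j w⊑u (loose cj first)))
        i<j (subst (λ z → inv v ℕ.< inv z) (sym back) lower))
      where
      v = swap u i j

      back : swap v i j ≡ u
      back = swap-involutive u i<j

      lower : inv v ℕ.< inv u
      lower = subst (λ z → inv v ℕ.< inv z) back
        (inv-swap v i<j (subst₂ _<_ (sym (swap-fst u i<j)) (sym (swap-snd u i<j)) uj<ui))

-- The maximal element

w₀-antitone : {i j : Fin n} → i < j → w₀ {n} ‼ j < w₀ {n} ‼ i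
w₀-antitone {n} {i} {j} i<j = subst₂ ℕ._<_ (sym (value j)) (sym (value i)) (ℕₚ.∸-monoʳ-< (s≤s i<j) (toℕ<n j))
  where
  value : ∀ k → toℕ (w₀ {n} ‼ k) ≡ n ℕ.∸ suc (toℕ k)
  value k = trans (cong toℕ (lookup∘tabulate opposite k)) (opposite-prop k)

w₀-isPermutation : IsPermutation (w₀ {n})
w₀-isPermutation {n} i j eq with <-cmp i j
... | tri< i<j _ _ = contradiction (sym eq) (<⇒≢ (w₀-antitone i<j))
... | tri≈ _ i≡j _ = i≡j
... | tri> _ _ j<i = contradiction eq (<⇒≢ (w₀-antitone j<i))

-- If `b ≤ w₀ ‼ x`, every position up to `x` counts for `w₀`. Otherwise every value from `b` on sits
-- within the first positions of `w₀`, and there are equally many such values in `u`.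
⊑-w₀ : {u : Perm n} → IsPermutation u → u ⊑ w₀
⊑-w₀ {n} {u} u-perm x b with b ≤? w₀ {n} ‼ x
... | yes b≤w₀x = ∑-mono-≤ λ k → 𝟙-mono ((k ≤? x) ×-dec (b ≤? u ‼ k)) ((k ≤? x) ×-dec (b ≤? w₀ {n} ‼ k))
  λ (k≤x , _) → k≤x , ℕₚ.≤-trans b≤w₀x (antitone k≤x)
  where
  antitone : ∀ {k} → k ≤ x → w₀ {n} ‼ x ≤ w₀ {n} ‼ k
  antitone {k} k≤x with k ≟ x
  ... | yes refl = ℕₚ.≤-refl
  ... | no  k≢x  = ℕₚ.<⇒≤ (w₀-antitone (≤∧≢⇒< k≤x k≢x))
... | no b≰w₀x = begin
  rank u x b                       ≤⟨ ∑-mono-≤ (λ k → 𝟙-mono ((k ≤? x) ×-dec (b ≤? u ‼ k)) (b ≤? u ‼ k) proj₂) ⟩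
  sum (λ k → 𝟙 (b ≤? u ‼ k))       ≡⟨ ∑-perm u u-perm (λ v → 𝟙 (b ≤? v)) ⟩
  sum (λ (v : Fin n) → 𝟙 (b ≤? v)) ≡⟨ ∑-perm (w₀ {n}) w₀-isPermutation (λ v → 𝟙 (b ≤? v)) ⟨
  sum (λ k → 𝟙 (b ≤? w₀ {n} ‼ k))  ≤⟨ ∑-mono-≤ (λ k → 𝟙-mono (b ≤? w₀ {n} ‼ k) ((k ≤? x) ×-dec (b ≤? w₀ {n} ‼ k)) (early k)) ⟩
  rank w₀ x b                      ∎
  where
  open ℕₚ.≤-Reasoning
  early : ∀ k → b ≤ w₀ {n} ‼ k → k ≤ x × b ≤ w₀ {n} ‼ k
  early k b≤w₀k = ℕₚ.≮⇒≥ (λ x<k → b≰w₀x (ℕₚ.≤-trans b≤w₀k (ℕₚ.<⇒≤ (w₀-antitone x<k)))) , b≤w₀k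

⪯-w₀ : {u : Perm n} → IsPermutation u → u ⪯ w₀
⪯-w₀ {u = u} u-perm = ⊑⇒⪯ u-perm w₀-isPermutation (⊑-w₀ {u = u} u-perm)

-- Degrees increase along the Bruhat order

module Degree {n} (h : Fin n → Fin n) (h-hess : IsHessenberg h) (w : Perm n) where

  Edge : Fin n → Fin n → Set
  Edge i j = i < j × j ≤ h i

  edge? : ∀ i j → Dec (Edge i j)
  edge? i j = (i <? j) ×-dec (j ≤? h i)

  h-mono : ∀ {i j} → i ≤ j → h i ≤ h j
  h-mono {i} {j} = proj₁ h-hess i j

  -- Only the lower bound of the interval has to be recorded, as every permutation lies below `w₀`.
  Stays : Perm n → Fin n → Fin n → Set
  Stays u i j = Edge i j × w ⊑ swap u i j

  stays? : ∀ u i j → Dec (Stays u i j)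
  stays? u i j = edge? i j ×-dec (w ⊑? swap u i j)

  degree : Perm n → ℕ
  degree u = ∑² λ i j → 𝟙 (stays? u i j)

  module _ (u : Perm n) (w⊑u : w ⊑ u) {p q : Fin n} (p<q : p < q) (up<uq : u ‼ p < u ‼ q) where

    private
      v = swap u p q

      w⊑v : w ⊑ v
      w⊑v x b = ℕₚ.≤-trans (w⊑u x b) (ascent-⊑ u p<q up<uq x b)

    -- Loose at the positions i , j of v, which carry the values u i′ , u j′.
    Loose-v : Fin n → Fin n → Fin n → Fin n → Set
    Loose-v i′ j′ i j = ∀ x b → i ≤ x → x < j → u ‼ j′ < b → b ≤ u ‼ i′ → rank w x b ℕ.< rank v x b

    raise : ∀ {x b} → rank w x b ℕ.< rank u x b → rank w x b ℕ.< rank v x b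
    raise {x} {b} lt = ℕₚ.<-≤-trans lt (ascent-⊑ u p<q up<uq x b)

    -- In the rectangle of `(p , q)` the rank rises strictly, so no cell there is tight for `v`.
    inside : ∀ {x b} → p ≤ x → x < q → u ‼ p < b → b ≤ u ‼ q → rank w x b ℕ.< rank v x b
    inside {x} {b} p≤x x<q up<b b≤uq = ℕₚ.≤-<-trans (w⊑u x b) (rank-swap-rise u p<q p≤x x<q up<b b≤uq)

    stays-v : ∀ {i i′ j j′} → Transposed p q i i′ → Transposed p q j j′ → Edge i j → Loose-v i′ j′ i j → Stays v i j
    stays-v ti tj e@(i<j , _) loose = e , Loose⇒swap-⊑ w v i<j w⊑v λ x b i≤x x<j vj<b b≤vi →
      loose x b i≤x x<j (subst (_< b) (lookup-swap u p<q tj) vj<b) (subst (b ≤_) (lookup-swap u p<q ti) b≤vi)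

    -- An edge from `p` to some `k` beyond `q` is followed to `(q , k)`, and one from some `k`
    -- before `p` to `q` is followed to `(k , p)`: the same entries span fewer rows, and
    -- monotonicity of `h` or `p < q` keeps the pair an edge. All other edges stay in place, where
    -- new cells of the rectangle lie in that of `(p , q)`.
    moved : ∀ {i i′ j j′} → Transposed p q i i′ → Transposed p q j j′ → Edge i j → Loose w u i j →
            (Edge i j × Loose-v i′ j′ i j) ⊎ (Edge i′ j′ × Loose-v i j i′ j′)
    moved at-p at-p (p<p , _) _ = contradiction p<p (ℕₚ.<-irrefl refl)
    moved at-p at-q e loose = inj₁ (e , λ x b → inside)
    moved at-p (off {k} _ k≢q) e@(p<k , k≤hp) loose with <-cmp k q
    ... | tri< k<q _ _ = inj₁ (e , λ x b p≤x x<k uk<b b≤uq → case-row b p≤x x<k uk<b b≤uq)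
      where
      case-row : ∀ {x} b → p ≤ x → x < k → u ‼ k < b → b ≤ u ‼ q → rank w x b ℕ.< rank v x b
      case-row {x} b p≤x x<k uk<b b≤uq with b ≤? u ‼ p
      ... | yes b≤up = raise {x} {b} (loose x b p≤x x<k uk<b b≤up)
      ... | no  b≰up = inside p≤x (ℕₚ.<-trans x<k k<q) (ℕₚ.≰⇒> b≰up) b≤uq
    ... | tri≈ _ k≡q _ = contradiction k≡q k≢q
    ... | tri> _ _ q<k = inj₂ ((q<k , ℕₚ.≤-trans k≤hp (h-mono (ℕₚ.<⇒≤ p<q))) ,
      λ x b q≤x x<k uk<b b≤up → raise {x} {b} (loose x b (ℕₚ.≤-trans (ℕₚ.<⇒≤ p<q) q≤x) x<k uk<b b≤up))
    moved at-q at-p (q<p , _) _ = contradiction q<p (ℕₚ.<-asym p<q)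
    moved at-q at-q (q<q , _) _ = contradiction q<q (ℕₚ.<-irrefl refl)
    moved at-q (off _ _) e loose = inj₁ (e , λ x b q≤x x<k uk<b b≤up →
      raise {x} {b} (loose x b q≤x x<k uk<b (ℕₚ.≤-trans b≤up (ℕₚ.<⇒≤ up<uq))))
    moved (off _ _) at-p e loose = inj₁ (e , λ x b k≤x x<p uq<b b≤uk →
      raise {x} {b} (loose x b k≤x x<p (ℕₚ.<-trans up<uq uq<b) b≤uk))
    moved (off {k} k≢p _) at-q e@(k<q , q≤hk) loose with <-cmp k p
    ... | tri< k<p _ _ = inj₂ ((k<p , ℕₚ.≤-trans (ℕₚ.<⇒≤ p<q) q≤hk) ,
      λ x b k≤x x<p uq<b b≤uk → raise {x} {b} (loose x b k≤x (ℕₚ.<-trans x<p p<q) uq<b b≤uk))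
    ... | tri≈ _ k≡p _ = contradiction k≡p k≢p
    ... | tri> _ _ p<k = inj₁ (e , λ x b → case-row b)
      where
      case-row : ∀ {x} b → k ≤ x → x < q → u ‼ p < b → b ≤ u ‼ k → rank w x b ℕ.< rank v x b
      case-row {x} b k≤x x<q up<b b≤uk with b ≤? u ‼ q
      ... | yes b≤uq = inside (ℕₚ.≤-trans (ℕₚ.<⇒≤ p<k) k≤x) x<q up<b b≤uq
      ... | no  b≰uq = raise {x} {b} (loose x b k≤x x<q (ℕₚ.≰⇒> b≰uq) b≤uk)
    moved (off _ _) (off _ _) e loose = inj₁ (e , λ x b i≤x x<j uj<b b≤ui → raise {x} {b} (loose x b i≤x x<j uj<b b≤ui))

    -- The rectangle in `v` is covered by the two loose rectangles in `u` together with that of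
    -- `(p , q)`.
    both : ∀ {i i′ j j′} → Transposed p q i i′ → Transposed p q j j′ → i < j → i′ < j′ →
           Loose w u i j → Loose w u i′ j′ → Loose-v i′ j′ i j
    both at-p at-p p<p _ _ _ = contradiction p<p (ℕₚ.<-irrefl refl)
    both at-p at-q _ q<p _ _ = contradiction q<p (ℕₚ.<-asym p<q)
    both at-p (off {k} _ _) p<k q<k loose loose′ x b p≤x x<k uk<b b≤uq with b ≤? u ‼ p | q ≤? x
    ... | yes b≤up | _       = raise {x} {b} (loose x b p≤x x<k uk<b b≤up)
    ... | no  _    | yes q≤x = raise {x} {b} (loose′ x b q≤x x<k uk<b b≤uq)
    ... | no  b≰up | no  q≰x = inside p≤x (ℕₚ.≰⇒> q≰x) (ℕₚ.≰⇒> b≰up) b≤uq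
    both at-q at-p q<p _ _ _ = contradiction q<p (ℕₚ.<-asym p<q)
    both at-q at-q q<q _ _ _ = contradiction q<q (ℕₚ.<-irrefl refl)
    both at-q (off _ _) _ _ loose _ x b q≤x x<k uk<b b≤up =
      raise {x} {b} (loose x b q≤x x<k uk<b (ℕₚ.≤-trans b≤up (ℕₚ.<⇒≤ up<uq)))
    both (off _ _) at-p _ _ loose _ x b k≤x x<p uq<b b≤uk =
      raise {x} {b} (loose x b k≤x x<p (ℕₚ.<-trans up<uq uq<b) b≤uk)
    both (off {k} _ _) at-q k<q k<p loose loose′ x b k≤x x<q up<b b≤uk with b ≤? u ‼ q | p ≤? x
    ... | no  b≰uq | _       = raise {x} {b} (loose x b k≤x x<q (ℕₚ.≰⇒> b≰uq) b≤uk)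
    ... | yes _    | no  p≰x = raise {x} {b} (loose′ x b k≤x (ℕₚ.≰⇒> p≰x) up<b b≤uk)
    ... | yes b≤uq | yes p≤x = inside p≤x x<q up<b b≤uq
    both (off _ _) (off _ _) _ _ loose _ x b i≤x x<j uj<b b≤ui = raise {x} {b} (loose x b i≤x x<j uj<b b≤ui)

    either : ∀ {i i′ j j′} → Transposed p q i i′ → Transposed p q j j′ → Stays u i j → Stays v i j ⊎ Stays v i′ j′
    either ti tj (e , w⊑) with moved ti tj e (swap-⊑⇒Loose w u (proj₁ e) w⊑)
    ... | inj₁ (e′ , loose) = inj₁ (stays-v ti tj e′ loose)
    ... | inj₂ (e′ , loose) = inj₂ (stays-v (Transposed-sym ti) (Transposed-sym tj) e′ loose)

    degree-ascent : degree u ℕ.≤ degree v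
    degree-ascent = exchange-≤ p q _ _ λ i j → le (transposed p q i) (transposed p q j)
      where
      le : ∀ {i i′ j j′} → Transposed p q i i′ → Transposed p q j j′ →
           𝟙 (stays? u i j) + 𝟙 (stays? u i′ j′) ℕ.≤ 𝟙 (stays? v i j) + 𝟙 (stays? v i′ j′)
      le {i} {i′} {j} {j′} ti tj = 𝟙-exchange (stays? u i j) (stays? u i′ j′) (stays? v i j) (stays? v i′ j′)
        (either ti tj)
        (⊎-swap ∘ either (Transposed-sym ti) (Transposed-sym tj))
        λ (e , w⊑) (e′ , w⊑′) →
          let loose  = swap-⊑⇒Loose w u (proj₁ e) w⊑
              loose′ = swap-⊑⇒Loose w u (proj₁ e′) w⊑′
          in stays-v ti tj e (both ti tj (proj₁ e) (proj₁ e′) loose loose′)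
           , stays-v (Transposed-sym ti) (Transposed-sym tj) e′
               (both (Transposed-sym ti) (Transposed-sym tj) (proj₁ e′) (proj₁ e) loose′ loose)

  degree-mono : ∀ {u v} → w ⊑ u → u ⪯ v → degree u ℕ.≤ degree v
  degree-mono w⊑u ⪯-refl = ℕₚ.≤-refl
  degree-mono w⊑u (⪯-step {v} i j u⪯v i<j lt) = ℕₚ.≤-trans (degree-mono w⊑u u⪯v)
    (degree-ascent v (λ x b → ℕₚ.≤-trans (w⊑u x b) (⪯⇒⊑ u⪯v x b)) i<j (inv-swap⁻¹ v i<j lt))

-- Comparison of w with w₀

-- Both exchanged positions inherit the witness of `v ‼ p`, the smaller entry and the one further
-- left. In `⪯-upper` they inherit that of `v ‼ q`.
⪯-lower : {w u : Perm n} → w ⪯ u → ∀ i → ∃ λ k → k ≤ i × w ‼ k ≤ u ‼ i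
⪯-lower ⪯-refl i = i , ℕₚ.≤-refl , ℕₚ.≤-refl
⪯-lower {w = w} (⪯-step {v} p q w⪯v p<q lt) i = go (transposed p q i)
  where
  go : ∀ {i i′} → Transposed p q i i′ → ∃ λ k → k ≤ i × w ‼ k ≤ swap v p q ‼ i
  go at-p with ⪯-lower w⪯v p
  ... | k , k≤p , wk≤vp = k , k≤p ,
    subst (w ‼ k ≤_) (sym (swap-fst v p<q)) (ℕₚ.≤-trans wk≤vp (ℕₚ.<⇒≤ (inv-swap⁻¹ v p<q lt)))
  go at-q with ⪯-lower w⪯v p
  ... | k , k≤p , wk≤vp = k , ℕₚ.≤-trans k≤p (ℕₚ.<⇒≤ p<q) , subst (w ‼ k ≤_) (sym (swap-snd v p<q)) wk≤vp
  go (off {i} i≢p i≢q) with ⪯-lower w⪯v i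
  ... | k , k≤i , wk≤vi = k , k≤i , subst (w ‼ k ≤_) (sym (swap-off v p<q i≢p i≢q)) wk≤vi

⪯-upper : {w u : Perm n} → w ⪯ u → ∀ i → ∃ λ l → i ≤ l × u ‼ i ≤ w ‼ l
⪯-upper ⪯-refl i = i , ℕₚ.≤-refl , ℕₚ.≤-refl
⪯-upper {w = w} (⪯-step {v} p q w⪯v p<q lt) i = go (transposed p q i)
  where
  go : ∀ {i i′} → Transposed p q i i′ → ∃ λ l → i ≤ l × swap v p q ‼ i ≤ w ‼ l
  go at-p with ⪯-upper w⪯v q
  ... | l , q≤l , vq≤wl = l , ℕₚ.≤-trans (ℕₚ.<⇒≤ p<q) q≤l , subst (_≤ w ‼ l) (sym (swap-fst v p<q)) vq≤wl
  go at-q with ⪯-upper w⪯v q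
  ... | l , q≤l , vq≤wl = l , q≤l ,
    subst (_≤ w ‼ l) (sym (swap-snd v p<q)) (ℕₚ.≤-trans (ℕₚ.<⇒≤ (inv-swap⁻¹ v p<q lt)) vq≤wl)
  go (off {i} i≢p i≢q) with ⪯-upper w⪯v i
  ... | l , i≤l , vi≤wl = l , i≤l , subst (_≤ w ‼ l) (sym (swap-off v p<q i≢p i≢q)) vi≤wl

-- The total number of positions with a value in Q is the same for f and g,
-- and f puts values in Q on all of N as soon as it puts one on E.
count-transfer : (f g : Perm n) → IsPermutation f → IsPermutation g →
  {E N Q : Fin n → Set} (E? : ∀ i → Dec (E i)) (N? : ∀ i → Dec (N i)) (Q? : ∀ v → Dec (Q v)) →
  (∀ i → Q (g ‼ i) → E i ⊎ N i) → (∀ i → E i → ¬ N i) →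
  (∀ {x y} → E x → Q (f ‼ x) → N y → Q (f ‼ y)) →
  sum (λ i → 𝟙 (E? i ×-dec Q? (f ‼ i))) ℕ.≤ sum (λ i → 𝟙 (E? i ×-dec Q? (g ‼ i)))
count-transfer f g f-perm g-perm E? N? Q? cover disjoint spread with any? (λ i → E? i ×-dec Q? (f ‼ i))
... | no none = ∑-mono-≤ λ i → 𝟙-mono (E? i ×-dec Q? (f ‼ i)) (E? i ×-dec Q? (g ‼ i)) λ hit → contradiction (i , hit) none
... | yes (x , Ex , Qfx) = ℕₚ.+-cancelʳ-≤ (sum (λ i → 𝟙 (N? i))) _ _ (begin
  sum (λ i → 𝟙 (E? i ×-dec Q? (f ‼ i))) + sum (λ i → 𝟙 (N? i))
    ≡⟨ ∑-distrib-+ (λ i → 𝟙 (E? i ×-dec Q? (f ‼ i))) (λ i → 𝟙 (N? i)) ⟨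
  sum (λ i → 𝟙 (E? i ×-dec Q? (f ‼ i)) + 𝟙 (N? i))
    -- `no id` decides the empty event and contributes 0, so `𝟙-exchange` bounds two indicators by a
    -- single one.
    ≤⟨ ∑-mono-≤ (λ i → ℕₚ.≤-trans (𝟙-exchange (E? i ×-dec Q? (f ‼ i)) (N? i) (Q? (f ‼ i)) (no id)
         (inj₁ ∘ proj₂) (λ Ni → inj₁ (spread Ex Qfx Ni)) (λ (Ei , _) Ni → contradiction Ni (disjoint i Ei)))
         (ℕₚ.≤-reflexive (ℕₚ.+-identityʳ _))) ⟩
  sum (λ i → 𝟙 (Q? (f ‼ i)))
    ≡⟨ ∑-perm f f-perm (λ v → 𝟙 (Q? v)) ⟩
  sum (λ v → 𝟙 (Q? v))
    ≡⟨ ∑-perm g g-perm (λ v → 𝟙 (Q? v)) ⟨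
  sum (λ i → 𝟙 (Q? (g ‼ i)))
    ≤⟨ ∑-mono-≤ (λ i → 𝟙-exchange (no id) (Q? (g ‼ i)) (E? i ×-dec Q? (g ‼ i)) (N? i) ⊥-elim (split i) ⊥-elim) ⟩
  sum (λ i → 𝟙 (E? i ×-dec Q? (g ‼ i)) + 𝟙 (N? i))
    ≡⟨ ∑-distrib-+ (λ i → 𝟙 (E? i ×-dec Q? (g ‼ i))) (λ i → 𝟙 (N? i)) ⟩
  sum (λ i → 𝟙 (E? i ×-dec Q? (g ‼ i))) + sum (λ i → 𝟙 (N? i)) ∎)
  where
  open ℕₚ.≤-Reasoning
  split : ∀ i → _ → _
  split i Qgi with cover i Qgi
  ... | inj₁ Ei = inj₁ (Ei , Qgi)
  ... | inj₂ Ni = inj₂ Ni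

∑²-mono-columns : {f g : Fin n → Fin n → ℕ} → (∀ j → sum (λ i → f i j) ℕ.≤ sum (λ i → g i j)) → ∑² f ℕ.≤ ∑² g
∑²-mono-columns {f = f} {g} le = subst₂ ℕ._≤_ (sym (∑-comm f)) (sym (∑-comm g)) (∑-mono-≤ le)

-- Inclusion-exclusion at one pair of positions. This half serves at `w₀`, where staying excludes
-- being above or below; `𝟙-partition-≥` serves at `w`, where these three cases cover all edges.
𝟙-partition-≤ : {S E : Set} (s? : Dec S) (e? : Dec E) (a? : Dec A) (b? : Dec B) → (S → E × ¬ A × ¬ B) →
  𝟙 s? + (𝟙 (e? ×-dec a?) + 𝟙 (e? ×-dec b?)) ℕ.≤ 𝟙 e? + 𝟙 (e? ×-dec a? ×-dec b?)
𝟙-partition-≤ (yes s) e? a? b? f with f s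
𝟙-partition-≤ (yes s) (no ¬e) a? b? f | e , _ = contradiction e ¬e
𝟙-partition-≤ (yes s) (yes _) (yes a) b? f | _ , ¬a , _ = contradiction a ¬a
𝟙-partition-≤ (yes s) (yes _) (no _) (yes b) f | _ , _ , ¬b = contradiction b ¬b
𝟙-partition-≤ (yes s) (yes _) (no _) (no _) f | _ = ℕₚ.≤-refl
𝟙-partition-≤ (no _) (no _)  _       _       f = z≤n
𝟙-partition-≤ (no _) (yes _) (yes _) (yes _) f = ℕₚ.≤-refl
𝟙-partition-≤ (no _) (yes _) (yes _) (no _)  f = ℕₚ.≤-refl
𝟙-partition-≤ (no _) (yes _) (no _)  (yes _) f = ℕₚ.≤-refl
𝟙-partition-≤ (no _) (yes _) (no _)  (no _)  f = z≤n

𝟙-partition-≥ : {S E : Set} (s? : Dec S) (e? : Dec E) (a? : Dec A) (b? : Dec B) → (E → S ⊎ A ⊎ B) →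
  𝟙 e? + 𝟙 (e? ×-dec a? ×-dec b?) ℕ.≤ 𝟙 s? + (𝟙 (e? ×-dec a?) + 𝟙 (e? ×-dec b?))
𝟙-partition-≥ s? (no _)  a?      b?      f = z≤n
𝟙-partition-≥ s? (yes _) (yes _) (yes _) f = ℕₚ.m≤n+m 2 (𝟙 s?)
𝟙-partition-≥ s? (yes _) (yes _) (no _)  f = ℕₚ.m≤n+m 1 (𝟙 s?)
𝟙-partition-≥ s? (yes _) (no _)  (yes _) f = ℕₚ.m≤n+m 1 (𝟙 s?)
𝟙-partition-≥ (yes _) (yes _) (no _) (no _) f = ℕₚ.≤-refl
𝟙-partition-≥ (no ¬s) (yes e) (no ¬a) (no ¬b) f with f e
... | inj₁ s        = contradiction s ¬s
... | inj₂ (inj₁ a) = contradiction a ¬a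
... | inj₂ (inj₂ b) = contradiction b ¬b

-- Injectivity is asked on the list alone: a swap determines its two positions once they are known
-- to be increasing.
unique-map-on : {f : A → B} {xs : List A} → (∀ {x y} → x ∈ xs → y ∈ xs → f x ≡ f y → x ≡ y) →
  Unique xs → Unique (List.map f xs)
unique-map-on {xs = []}     inj []        = []
unique-map-on {xs = x ∷ xs} inj (x∉ ∷ uniq) =
  Allₚ.map⁺ (All.tabulate λ y∈ eq → All.lookup x∉ y∈ (inj (here refl) (there y∈) eq))
  ∷ unique-map-on (λ x∈ y∈ → inj (there x∈) (there y∈)) uniq

-- Consequences of the generator condition and the avoided patterns

module Patterns {n} (h : Fin n → Fin n) (w : Perm n) (h-hess : IsHessenberg h) (w-perm : IsPermutation w)
  (gen : IsGenerator h w) (no2143 : ¬ Contains2143 h w) (no1324 : ¬ Contains1324 h w) (no1243 : ¬ Contains1243 h w)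
  (no2134 : ¬ Contains2134 h w) (no1423 : ¬ Contains1423 h w) (no2314 : ¬ Contains2314 h w)
  (no2413 : ¬ Contains2413 h w) where

  open Degree h h-hess w public

  private
    W : Fin n → Fin n
    W = w ‼_

  ≤h : ∀ i → i ≤ h i
  ≤h = proj₂ h-hess

  h<h⇒< : ∀ {i j} → h i < h j → i < j
  h<h⇒< {i} {j} hi<hj = ℕₚ.≰⇒> λ j≤i → ℕₚ.<⇒≱ hi<hj (h-mono j≤i)

  -- The larger value `W m` keeps the successor of `W y` in range, and the generator condition
  -- bounds its position.
  next : ∀ {y m} → W y < W m → ∃ λ z → toℕ (W z) ≡ suc (toℕ (W y)) × z ≤ h y
  next {y} {m} Wy<Wm with position w w-perm (fromℕ< (ℕₚ.≤-<-trans Wy<Wm (toℕ<n (W m))))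
  ... | z , Wz≡ = z , eq , gen y z eq
    where
    eq : toℕ (W z) ≡ suc (toℕ (W y))
    eq = trans (cong toℕ Wz≡) (toℕ-fromℕ< _)

  prev : ∀ {y m} → W m < W y → ∃ λ z → toℕ (W y) ≡ suc (toℕ (W z)) × y ≤ h z
  prev {y} {m} Wm<Wy with toℕ (W y) in eq
  prev {y} {m} (s≤s Wm≤a) | suc a with position w w-perm (fromℕ< (ℕₚ.<-trans (ℕₚ.≤-reflexive (sym eq)) (toℕ<n (W y))))
  ... | z , Wz≡ = z , cong suc (sym Wz≡a) , gen z y (trans eq (cong suc (sym Wz≡a)))
    where
    Wz≡a : toℕ (W z) ≡ a
    Wz≡a = trans (cong toℕ Wz≡) (toℕ-fromℕ< _)

  W-≤∧≢⇒< : ∀ {i j} → W i ≤ W j → i ≢ j → W i < W j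
  W-≤∧≢⇒< Wi≤Wj i≢j = ≤∧≢⇒< Wi≤Wj (i≢j ∘ w-perm _ _)

  Crossing : (p m q : Fin n) → Set
  Crossing p m q = ∃ λ z → ∃ λ z′ → z < m × m < z′ × z′ ≤ h z × W p ≤ W z × W z < W z′ × W z′ ≤ W q

  -- Climbing from the value at p to the value at q one unit at a time, some step jumps over position m.
  crossing : ∀ {p m q} → p < m → m < q → W p < W q → ¬ (W p ≤ W m × W m ≤ W q) → Crossing p m q
  crossing {p} {m} {q} p<m m<q Wp<Wq avoid = go (toℕ (W q)) (ℕₚ.m≤m+n _ _) p<m Wp<Wq ℕₚ.≤-refl
    where
    -- `d` is fuel: it bounds the number of unit steps left to `W q`.
    go : ∀ d {y} → toℕ (W q) ℕ.≤ d + toℕ (W y) → y < m → W y < W q → W p ≤ W y → Crossing p m q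
    go zero    bound _ Wy<Wq _ = contradiction bound (ℕₚ.<⇒≱ Wy<Wq)
    go (suc d) {y} bound y<m Wy<Wq Wp≤Wy with next Wy<Wq
    ... | z , Wz≡ , z≤hy = step (<-cmp z m)
      where
      Wy<Wz : W y < W z
      Wy<Wz = ℕₚ.≤-reflexive (sym Wz≡)

      Wz≤Wq : W z ≤ W q
      Wz≤Wq = ℕₚ.≤-trans (ℕₚ.≤-reflexive Wz≡) Wy<Wq

      step : Tri (z < m) (z ≡ m) (m < z) → Crossing p m q
      step (tri< z<m _ _) = go d
        (subst (toℕ (W q) ℕ.≤_) (trans (sym (ℕₚ.+-suc d _)) (cong (d +_) (sym Wz≡))) bound) z<m
        (W-≤∧≢⇒< Wz≤Wq (<⇒≢ (ℕₚ.<-trans z<m m<q))) (ℕₚ.≤-trans Wp≤Wy (ℕₚ.<⇒≤ Wy<Wz))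
      step (tri≈ _ refl _) = contradiction (ℕₚ.≤-trans Wp≤Wy (ℕₚ.<⇒≤ Wy<Wz) , Wz≤Wq) avoid
      step (tri> _ _ m<z) = y , z , y<m , m<z , z≤hy , Wp≤Wy , Wy<Wz , Wz≤Wq

  -- Replacing y by the position of the next value eventually reaches a position adjacent to j.
  no132 : ∀ {y x j} → h y < j → x < j → j ≤ h x → W y < W j → ¬ W j < W x
  no132 {y} {x} {j} hy<j x<j j≤hx Wy<Wj Wj<Wx = go (toℕ (W j)) (ℕₚ.m≤m+n _ _) hy<j Wy<Wj
    where
    go : ∀ d {y} → toℕ (W j) ℕ.≤ d + toℕ (W y) → h y < j → ¬ W y < W j
    go zero    bound _ Wy<Wj = ℕₚ.<⇒≱ Wy<Wj bound
    go (suc d) {y} bound hy<j Wy<Wj with next Wy<Wj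
    ... | z , Wz≡ , z≤hy = step (j ≤? h z)
      where
      z<j : z < j
      z<j = ℕₚ.≤-<-trans z≤hy hy<j

      Wy<Wz : W y < W z
      Wy<Wz = ℕₚ.≤-reflexive (sym Wz≡)

      Wz<Wj : W z < W j
      Wz<Wj = W-≤∧≢⇒< (ℕₚ.≤-trans (ℕₚ.≤-reflexive Wz≡) Wy<Wj) (<⇒≢ z<j)

      -- Here `y` is the last position not adjacent to `j`. With `x` and `j`, it and `z` form 1243
      -- or 1423, according to the side of `x` on which `z` lies.
      pattern-at : j ≤ h z → Tri (z < x) (z ≡ x) (x < z) → ⊥
      pattern-at j≤hz (tri< z<x _ _) = no1243 (y , z , x , j ,
        h<h⇒< (ℕₚ.<-≤-trans hy<j j≤hz) , z<x , x<j , j≤hz , z≤hy , hy<j , Wy<Wz , Wz<Wj , Wj<Wx)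
      pattern-at j≤hz (tri≈ _ refl _) = ℕₚ.<-asym Wz<Wj Wj<Wx
      pattern-at j≤hz (tri> _ _ x<z) = no1423 (y , x , z , j ,
        h<h⇒< (ℕₚ.<-≤-trans hy<j j≤hx) , x<z , z<j , j≤hx , z≤hy , hy<j , Wy<Wz , Wz<Wj , Wj<Wx)

      step : Dec (j ≤ h z) → ⊥
      step (yes j≤hz) = pattern-at j≤hz (<-cmp z x)
      step (no  j≰hz) = go d (subst (toℕ (W j) ℕ.≤_) (trans (sym (ℕₚ.+-suc d _)) (cong (d +_) (sym Wz≡))) bound)
        (ℕₚ.≰⇒> j≰hz) Wz<Wj

  -- Dual to `no132`: descending from `W y` by unit steps eventually reaches a position within
  -- `h i`, which completes 2314 or 2134.
  no213 : ∀ {i x y} → h i < y → i < x → x ≤ h i → W x < W i → ¬ W i < W y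
  no213 {i} {x} {y} hi<y i<x x≤hi Wx<Wi Wi<Wy = go (toℕ (W y)) (ℕₚ.m≤m+n _ _) hi<y Wi<Wy
    where
    go : ∀ d {y} → toℕ (W y) ℕ.≤ d + toℕ (W i) → h i < y → ¬ W i < W y
    go zero    bound _ Wi<Wy = ℕₚ.<⇒≱ Wi<Wy bound
    go (suc d) {y} bound hi<y Wi<Wy with prev Wi<Wy
    ... | z , Wy≡ , y≤hz = step (z ≤? h i)
      where
      i<z : i < z
      i<z = h<h⇒< (ℕₚ.<-≤-trans hi<y y≤hz)

      Wz<Wy : W z < W y
      Wz<Wy = ℕₚ.≤-reflexive (sym Wy≡)

      Wi<Wz : W i < W z
      Wi<Wz = W-≤∧≢⇒< (ℕ.s≤s⁻¹ (ℕₚ.≤-trans Wi<Wy (ℕₚ.≤-reflexive Wy≡))) (<⇒≢ i<z)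

      pattern-at : z ≤ h i → Tri (z < x) (z ≡ x) (x < z) → ⊥
      pattern-at z≤hi (tri< z<x _ _) = no2314 (i , z , x , y ,
        i<z , z<x , ℕₚ.≤-<-trans x≤hi hi<y , y≤hz , x≤hi , hi<y , Wx<Wi , Wi<Wz , Wz<Wy)
      pattern-at z≤hi (tri≈ _ refl _) = ℕₚ.<-asym Wx<Wi Wi<Wz
      pattern-at z≤hi (tri> _ _ x<z) = no2134 (i , x , z , y ,
        i<x , x<z , ℕₚ.≤-<-trans z≤hi hi<y , y≤hz , z≤hi , hi<y , Wx<Wi , Wi<Wz , Wz<Wy)

      step : Dec (z ≤ h i) → ⊥
      step (yes z≤hi) = pattern-at z≤hi (<-cmp z x)
      step (no  z≰hi) = go d (ℕ.s≤s⁻¹ (subst (ℕ._≤ suc (d + toℕ (W i))) Wy≡ bound)) (ℕₚ.≰⇒> z≰hi) Wi<Wz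

  -- Crossing x shows that y is adjacent to x, and crossing j yields the last letter of the pattern 2413.
  no2413-left : ∀ {y x j l} → h y < j → x < j → j ≤ h x → j < l → W j < W y → W y < W l → ¬ W l < W x
  no2413-left {y} {x} {j} {l} hy<j x<j j≤hx j<l Wj<Wy Wy<Wl Wl<Wx = contains
    (crossing y<x (ℕₚ.<-trans x<j j<l) Wy<Wl (λ (_ , Wx≤Wl) → ℕₚ.<⇒≱ Wl<Wx Wx≤Wl))
    (crossing (ℕₚ.<-trans y<x x<j) j<l Wy<Wl (λ (Wy≤Wj , _) → ℕₚ.<⇒≱ Wj<Wy Wy≤Wj))
    where
    y<x : y < x
    y<x = h<h⇒< (ℕₚ.<-≤-trans hy<j j≤hx)

    contains : Crossing y x l → Crossing y j l → ⊥
    contains (a , a′ , a<x , x<a′ , a′≤ha , Wy≤Wa , Wa<Wa′ , Wa′≤Wl)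
             (b , b′ , b<j , j<b′ , b′≤hb , Wy≤Wb , Wb<Wb′ , Wb′≤Wl) =
      no2413 (y , x , j , b′ , y<x , x≤hy , hy<j , j≤hx , hx<b′ ,
        ℕₚ.≤-trans b′≤hb (h-mono (ℕₚ.<⇒≤ b<j)) , Wj<Wy , Wy<Wb′ , Wb′<Wx)
      where
      Wy<Wb′ : W y < W b′
      Wy<Wb′ = ℕₚ.≤-<-trans Wy≤Wb Wb<Wb′

      Wb′<Wx : W b′ < W x
      Wb′<Wx = ℕₚ.≤-<-trans Wb′≤Wl Wl<Wx

      x≤hy : x ≤ h y
      x≤hy = ℕₚ.≮⇒≥ λ hy<x → no132 (ℕₚ.<-trans hy<x x<a′) x<a′ (ℕₚ.≤-trans a′≤ha (h-mono (ℕₚ.<⇒≤ a<x)))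
        (ℕₚ.≤-<-trans Wy≤Wa Wa<Wa′) (ℕₚ.≤-<-trans Wa′≤Wl Wl<Wx)

      hx<b′ : h x < b′
      hx<b′ = ℕₚ.≰⇒> λ b′≤hx → no132 (ℕₚ.<-trans hy<j j<b′) (ℕₚ.<-trans x<j j<b′) b′≤hx Wy<Wb′ Wb′<Wx

  -- Dual to `no2413-left`: crossing `x` shows that `y` is adjacent to `x`, and crossing `i` yields
  -- the first letter of the pattern 2413.
  no2413-right : ∀ {i x y k} → h i < y → i < x → x ≤ h i → k < i → W y < W i → W k < W y → ¬ W x < W k
  no2413-right {i} {x} {y} {k} hi<y i<x x≤hi k<i Wy<Wi Wk<Wy Wx<Wk = contains
    (crossing (ℕₚ.<-trans k<i i<x) x<y Wk<Wy (λ (Wk≤Wx , _) → ℕₚ.<⇒≱ Wx<Wk Wk≤Wx))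
    (crossing k<i (ℕₚ.<-trans i<x x<y) Wk<Wy (λ (_ , Wi≤Wy) → ℕₚ.<⇒≱ Wy<Wi Wi≤Wy))
    where
    x<y : x < y
    x<y = ℕₚ.≤-<-trans x≤hi hi<y

    contains : Crossing k x y → Crossing k i y → ⊥
    contains (a , a′ , a<x , x<a′ , a′≤ha , Wk≤Wa , Wa<Wa′ , Wa′≤Wy)
             (b , b′ , b<i , i<b′ , b′≤hb , Wk≤Wb , Wb<Wb′ , Wb′≤Wy) =
      no2413 (b , i , x , y , b<i , ℕₚ.<⇒≤ (ℕₚ.<-≤-trans i<b′ b′≤hb) , hb<x , x≤hi , hi<y , y≤hx , Wx<Wb , Wb<Wy , Wy<Wi)
      where
      Wx<Wb : W x < W b
      Wx<Wb = ℕₚ.<-≤-trans Wx<Wk Wk≤Wb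

      Wb<Wy : W b < W y
      Wb<Wy = ℕₚ.<-≤-trans Wb<Wb′ Wb′≤Wy

      y≤hx : y ≤ h x
      y≤hx = ℕₚ.≮⇒≥ λ hx<y → no213 (ℕₚ.≤-<-trans (h-mono (ℕₚ.<⇒≤ a<x)) hx<y) a<x
        (ℕₚ.<⇒≤ (ℕₚ.<-≤-trans x<a′ a′≤ha)) (ℕₚ.<-≤-trans Wx<Wk Wk≤Wa) (ℕₚ.<-≤-trans Wa<Wa′ Wa′≤Wy)

      hb<x : h b < x
      hb<x = ℕₚ.≰⇒> λ x≤hb → no213 (ℕₚ.≤-<-trans (h-mono (ℕₚ.<⇒≤ b<i)) hi<y) (ℕₚ.<-trans b<i i<x) x≤hb Wx<Wb Wb<Wy

  -- The first letter is moved to obtain the required adjacency: crossing `d` on the climb from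
  -- `W k` to `W l` gives a `z` adjacent to `d`, and `no213` then forces `l ≤ h z`.
  no2143-anywhere : ∀ {k d c l} → k < d → d < c → c < l → W d < W k → W k < W l → ¬ W l < W c
  no2143-anywhere {k} {d} {c} {l} k<d d<c c<l Wd<Wk Wk<Wl Wl<Wc
    with crossing k<d (ℕₚ.<-trans d<c c<l) Wk<Wl (λ (Wk≤Wd , _) → ℕₚ.<⇒≱ Wd<Wk Wk≤Wd)
  ... | z , z′ , z<d , d<z′ , z′≤hz , Wk≤Wz , Wz<Wz′ , Wz′≤Wl =
    no2143 (z , d , c , l , z<d , d<c , c<l , l≤hz , Wd<Wz , Wz<Wl , Wl<Wc)
    where
    Wd<Wz : W d < W z
    Wd<Wz = ℕₚ.<-≤-trans Wd<Wk Wk≤Wz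

    Wz<Wl : W z < W l
    Wz<Wl = ℕₚ.<-≤-trans Wz<Wz′ Wz′≤Wl

    l≤hz : l ≤ h z
    l≤hz = ℕₚ.≮⇒≥ λ hz<l → no213 hz<l z<d (ℕₚ.<⇒≤ (ℕₚ.<-≤-trans d<z′ z′≤hz)) Wd<Wz Wz<Wl

  -- The adjacencies demanded by 1324 are automatic: `no213` gives `l ≤ h i` and `no132` gives
  -- `j ≤ h k`.
  no1324-edge : ∀ {k i j l} → k < i → Edge i j → j < l → W k < W j → W j < W i → ¬ W i < W l
  no1324-edge {k} {i} {j} {l} k<i (i<j , j≤hi) j<l Wk<Wj Wj<Wi Wi<Wl = no1324 (k , i , j , l , k<i , i<j , j<l ,
    ℕₚ.≮⇒≥ (λ hi<l → no213 hi<l i<j j≤hi Wj<Wi Wi<Wl) ,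
    ℕₚ.≮⇒≥ (λ hk<j → no132 hk<j i<j j≤hi Wk<Wj Wj<Wi) , Wk<Wj , Wj<Wi , Wi<Wl)

  -- Edges above and below, counted at `w` and `w₀`

  W-cmp : ∀ {i j} → i ≢ j → W i < W j ⊎ W j < W i
  W-cmp {i} {j} i≢j with <-cmp (W i) (W j)
  ... | tri< lt _ _ = inj₁ lt
  ... | tri≈ _ eq _ = contradiction (w-perm i j eq) i≢j
  ... | tri> _ _ gt = inj₂ gt

  -- A condition on a value, so that the same predicate applies to the entries of `w` and of `w₀` in
  -- `count-transfer`.
  Above : Fin n → Fin n → Set
  Above j v = ∀ l → j ≤ l → W l < v

  Below : Fin n → Fin n → Set
  Below i v = ∀ k → k ≤ i → v < W k

  -- A failure at `l` is excluded by `no132` if `W y < W j`, and by `no2413-left` otherwise.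
  Above-spreads : ∀ {j x y} → Edge x j → Above j (W x) → h y < j → Above j (W y)
  Above-spreads {j} {x} {y} (x<j , j≤hx) above hy<j l j≤l with W-cmp {y} {l} (<⇒≢ (ℕₚ.<-≤-trans y<j j≤l))
    where
    y<j : y < j
    y<j = ℕₚ.≤-<-trans (≤h y) hy<j
  ... | inj₂ Wl<Wy = Wl<Wy
  ... | inj₁ Wy<Wl with j ≟ l
  ...   | yes refl = contradiction (above l j≤l) (no132 hy<j x<j j≤hx Wy<Wl)
  ...   | no j≢l with W-cmp {y} {j} (<⇒≢ (ℕₚ.≤-<-trans (≤h y) hy<j))
  ...     | inj₁ Wy<Wj = contradiction (above j ℕₚ.≤-refl) (no132 hy<j x<j j≤hx Wy<Wj)
  ...     | inj₂ Wj<Wy = contradiction (above l j≤l) (no2413-left hy<j x<j j≤hx (≤∧≢⇒< j≤l j≢l) Wj<Wy Wy<Wl)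

  Below-spreads : ∀ {i x y} → Edge i x → Below i (W x) → h i < y → Below i (W y)
  Below-spreads {i} {x} {y} (i<x , x≤hi) below hi<y k k≤i with W-cmp {k} {y} (<⇒≢ (ℕₚ.≤-<-trans k≤i (ℕₚ.≤-<-trans (≤h i) hi<y)))
  ... | inj₂ Wy<Wk = Wy<Wk
  ... | inj₁ Wk<Wy with k ≟ i
  ...   | yes refl = contradiction Wk<Wy (no213 hi<y i<x x≤hi (below k k≤i))
  ...   | no k≢i with W-cmp {i} {y} (<⇒≢ (ℕₚ.≤-<-trans (≤h i) hi<y))
  ...     | inj₁ Wi<Wy = contradiction Wi<Wy (no213 hi<y i<x x≤hi (below i ℕₚ.≤-refl))
  ...     | inj₂ Wy<Wi = contradiction (below k k≤i) (no2413-right hi<y i<x x≤hi (≤∧≢⇒< k≤i k≢i) Wy<Wi Wk<Wy)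

  Above? : ∀ j v → Dec (Above j v)
  Above? j v = all? λ l → (j ≤? l) →-dec (W l <? v)

  Below? : ∀ i v → Dec (Below i v)
  Below? i v = all? λ k → (k ≤? i) →-dec (v <? W k)

  w⪯w₀ : w ⪯ w₀
  w⪯w₀ = ⪯-w₀ w-perm

  edge∤nonedge : ∀ {i j} → Edge i j → ¬ h i < j
  edge∤nonedge (_ , j≤hi) hi<j = ℕₚ.<⇒≱ hi<j j≤hi

  edge-or-nonedge : ∀ {i j} → i < j → Edge i j ⊎ h i < j
  edge-or-nonedge {i} {j} i<j with j ≤? h i
  ... | yes j≤hi = inj₁ (i<j , j≤hi)
  ... | no  j≰hi = inj₂ (ℕₚ.≰⇒> j≰hi)

  Above⇒< : ∀ {u i j} → w ⪯ u → Above j (u ‼ i) → i < j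
  Above⇒< {i = i} w⪯u above with ⪯-upper w⪯u i
  ... | l , i≤l , ui≤Wl = ℕₚ.≰⇒> λ j≤i → ℕₚ.<⇒≱ (above l (ℕₚ.≤-trans j≤i i≤l)) ui≤Wl

  Below⇒< : ∀ {u i j} → w ⪯ u → Below i (u ‼ j) → i < j
  Below⇒< {j = j} w⪯u below with ⪯-lower w⪯u j
  ... | k , k≤j , Wk≤uj = ℕₚ.≰⇒> λ j≤i → ℕₚ.<⇒≱ (below k (ℕₚ.≤-trans k≤j j≤i)) Wk≤uj

  above? : (u : Perm n) → ∀ i j → Dec (Edge i j × Above j (u ‼ i))
  above? u i j = edge? i j ×-dec Above? j (u ‼ i)

  below? : (u : Perm n) → ∀ i j → Dec (Edge i j × Below i (u ‼ j))
  below? u i j = edge? i j ×-dec Below? i (u ‼ j)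

  -- Two permutations, because the passage from `w₀` to `w` changes the condition above column by
  -- column and then the condition below row by row.
  both? : (u v : Perm n) → ∀ i j → Dec (Edge i j × Above j (u ‼ i) × Below i (v ‼ j))
  both? u v i j = edge? i j ×-dec Above? j (u ‼ i) ×-dec Below? i (v ‼ j)

  -- A value above `j` must sit before `j`, on an edge or a non-edge of the column. One edge above
  -- makes all non-edges above, so what remains for the edges is minimal. For `w` this spreading
  -- uses the avoided patterns, for `w₀` in `above-≥` that its entries decrease.
  above-≤ : ∀ j → sum (λ i → 𝟙 (above? w i j)) ℕ.≤ sum (λ i → 𝟙 (above? w₀ i j))
  above-≤ j = count-transfer w w₀ w-perm w₀-isPermutation (λ i → edge? i j) (λ i → h i <? j) (Above? j)
    (λ i above → edge-or-nonedge (Above⇒< {u = w₀} w⪯w₀ above)) (λ _ → edge∤nonedge) Above-spreads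

  above-≥ : ∀ j → sum (λ i → 𝟙 (above? w₀ i j)) ℕ.≤ sum (λ i → 𝟙 (above? w i j))
  above-≥ j = count-transfer w₀ w w₀-isPermutation w-perm (λ i → edge? i j) (λ i → h i <? j) (Above? j)
    (λ i above → edge-or-nonedge (Above⇒< {u = w} ⪯-refl above)) (λ _ → edge∤nonedge)
    λ (_ , j≤hx) above hy<j l j≤l → ℕₚ.<-trans (above l j≤l) (w₀-antitone (h<h⇒< (ℕₚ.<-≤-trans hy<j j≤hx)))

  below-≤ : ∀ i → sum (λ j → 𝟙 (below? w i j)) ℕ.≤ sum (λ j → 𝟙 (below? w₀ i j))
  below-≤ i = count-transfer w w₀ w-perm w₀-isPermutation (edge? i) (λ j → h i <? j) (Below? i)
    (λ j below → edge-or-nonedge (Below⇒< {u = w₀} w⪯w₀ below)) (λ _ → edge∤nonedge) Below-spreads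

  below-≥ : ∀ i → sum (λ j → 𝟙 (below? w₀ i j)) ℕ.≤ sum (λ j → 𝟙 (below? w i j))
  below-≥ i = count-transfer w₀ w w₀-isPermutation w-perm (edge? i) (λ j → h i <? j) (Below? i)
    (λ j below → edge-or-nonedge (Below⇒< {u = w} ⪯-refl below)) (λ _ → edge∤nonedge)
    λ (_ , x≤hi) below hi<y k k≤i → ℕₚ.<-trans (w₀-antitone (ℕₚ.≤-<-trans x≤hi hi<y)) (below k k≤i)

  Linked : Fin n → Fin n → Set
  Linked i j = ∃ λ k → ∃ λ l → k ≤ i × j ≤ l × W k < W l

  linked? : ∀ i j → Dec (Linked i j)
  linked? i j = any? λ k → any? λ l → (k ≤? i) ×-dec (j ≤? l) ×-dec (W k <? W l)

  -- If the suffix from j and the prefix up to i are linked, Above j (W c) forces Below c (w₀ j) because w avoids 2143;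
  -- if not, Above j (W i) holds by itself.
  both-columns : ∀ j → sum (λ i → 𝟙 (both? w₀ w₀ i j)) ℕ.≤ sum (λ i → 𝟙 (both? w w₀ i j))
  both-columns j with any? (λ i → both? w₀ w₀ i j ×-dec linked? i j)
  ... | no none = ∑-mono-≤ λ i → 𝟙-mono (both? w₀ w₀ i j) (both? w w₀ i j) λ hit@(e , _ , below) → e , above i hit , below
    where
    above : ∀ i → Edge i j × Above j (w₀ {n} ‼ i) × Below i (w₀ {n} ‼ j) → Above j (W i)
    above i hit@((i<j , _) , _) l j≤l with W-cmp {l} {i} (<⇒≢ (ℕₚ.<-≤-trans i<j j≤l) ∘ sym)
    ... | inj₁ Wl<Wi = Wl<Wi
    ... | inj₂ Wi<Wl = contradiction (i , hit , i , l , ℕₚ.≤-refl , j≤l , Wi<Wl) none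
  ... | yes (i , (_ , _ , below) , k , l , k≤i , j≤l , Wk<Wl) = ℕₚ.≤-trans
    (∑-mono-≤ λ c → 𝟙-mono (both? w₀ w₀ c j) (above? w₀ c j) λ (e , above , _) → e , above)
    (ℕₚ.≤-trans (above-≥ j)
    (∑-mono-≤ λ c → 𝟙-mono (above? w c j) (both? w w₀ c j) λ (e , above) → e , above , below-c e above))
    where
    below-c : ∀ {c} → Edge c j → Above j (W c) → Below c (w₀ {n} ‼ j)
    below-c {c} (c<j , _) above d d≤c = ℕₚ.≰⇒> λ Wd≤w₀j →
      let i<d   = ℕₚ.≰⇒> λ d≤i → ℕₚ.<⇒≱ (below d d≤i) Wd≤w₀j
          Wd<Wk = ℕₚ.≤-<-trans Wd≤w₀j (below k k≤i)
          Wl<Wc = above l j≤l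
          d≢c   = λ d≡c → <⇒≢ (ℕₚ.<-trans Wd<Wk (ℕₚ.<-trans Wk<Wl Wl<Wc)) (cong W d≡c)
      in no2143-anywhere (ℕₚ.≤-<-trans k≤i i<d) (≤∧≢⇒< d≤c d≢c) (ℕₚ.<-≤-trans c<j j≤l) Wd<Wk Wk<Wl Wl<Wc

  -- Dual to `both-columns`: if linked, `Below i (W d)` forces `Above d (W i)` by avoidance of 2143;
  -- if not, `Below i (W j)` holds by itself.
  both-rows : ∀ i → sum (λ j → 𝟙 (both? w w₀ i j)) ℕ.≤ sum (λ j → 𝟙 (both? w w i j))
  both-rows i with any? (λ j → both? w w₀ i j ×-dec linked? i j)
  ... | no none = ∑-mono-≤ λ j → 𝟙-mono (both? w w₀ i j) (both? w w i j) λ hit@(e , above , _) → e , above , below j hit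
    where
    below : ∀ j → Edge i j × Above j (W i) × Below i (w₀ {n} ‼ j) → Below i (W j)
    below j hit@((i<j , _) , _) k k≤i with W-cmp {k} {j} (<⇒≢ (ℕₚ.≤-<-trans k≤i i<j))
    ... | inj₁ Wk<Wj = contradiction (j , hit , k , j , k≤i , ℕₚ.≤-refl , Wk<Wj) none
    ... | inj₂ Wj<Wk = Wj<Wk
  ... | yes (j , (_ , above , _) , k , l , k≤i , j≤l , Wk<Wl) = ℕₚ.≤-trans
    (∑-mono-≤ λ d → 𝟙-mono (both? w w₀ i d) (below? w₀ i d) λ (e , _ , below) → e , below)
    (ℕₚ.≤-trans (below-≥ i)
    (∑-mono-≤ λ d → 𝟙-mono (below? w i d) (both? w w i d) λ (e , below) → e , above-d e below , below))
    where
    above-d : ∀ {d} → Edge i d → Below i (W d) → Above d (W i)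
    above-d {d} (i<d , _) below c d≤c = ℕₚ.≰⇒> λ Wi≤Wc →
      let c<j = ℕₚ.≰⇒> λ j≤c → ℕₚ.<⇒≱ (above c j≤c) Wi≤Wc
          d≢c = λ d≡c → <⇒≢ (ℕₚ.<-≤-trans (below i ℕₚ.≤-refl) Wi≤Wc) (cong W d≡c)
      in no2143-anywhere (ℕₚ.≤-<-trans k≤i i<d) (≤∧≢⇒< d≤c d≢c) (ℕₚ.<-≤-trans c<j j≤l)
           (below k k≤i) Wk<Wl (ℕₚ.<-≤-trans (above l j≤l) Wi≤Wc)

  -- After the swap position `j` carries `w₀ ‼ i`, and `⪯-upper` demands an entry of `w` from `j` on
  -- that is at least as large; dually for position `i` and `⪯-lower`.
  stays-w₀ : ∀ {i j} → Stays w₀ i j → Edge i j × ¬ Above j (w₀ {n} ‼ i) × ¬ Below i (w₀ {n} ‼ j)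
  stays-w₀ {i} {j} (e@(i<j , _) , w⊑) = e , not-above , not-below
    where
    w⪯ : w ⪯ swap w₀ i j
    w⪯ = ⊑⇒⪯ w-perm (swap-isPermutation w₀ i<j w₀-isPermutation) w⊑

    not-above : ¬ Above j (w₀ {n} ‼ i)
    not-above above with ⪯-upper w⪯ j
    ... | l , j≤l , le = ℕₚ.<⇒≱ (above l j≤l) (subst (_≤ W l) (swap-snd w₀ i<j) le)

    not-below : ¬ Below i (w₀ {n} ‼ j)
    not-below below with ⪯-lower w⪯ i
    ... | k , k≤i , le = ℕₚ.<⇒≱ (below k k≤i) (subst (W k ≤_) (swap-fst w₀ i<j) le)

  -- Swapping an ascent goes up. At an inverted edge, a larger entry of `w` from `j` on and a
  -- smaller one up to `i` would complete 1324.
  edge-cases : ∀ {i j} → Edge i j → Stays w i j ⊎ Above j (W i) ⊎ Below i (W j)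
  edge-cases {i} {j} e@(i<j , _) with W-cmp (<⇒≢ i<j)
  ... | inj₁ Wi<Wj = inj₁ (e , ascent-⊑ w i<j Wi<Wj)
  ... | inj₂ Wj<Wi with any? (λ l → (j ≤? l) ×-dec (W i <? W l)) | any? (λ k → (k ≤? i) ×-dec (W k <? W j))
  ...   | no none | _ = inj₂ (inj₁ above)
    where
    above : Above j (W i)
    above l j≤l with W-cmp {l} {i} (<⇒≢ (ℕₚ.<-≤-trans i<j j≤l) ∘ sym)
    ... | inj₁ Wl<Wi = Wl<Wi
    ... | inj₂ Wi<Wl = contradiction (l , j≤l , Wi<Wl) none
  ...   | yes _ | no none = inj₂ (inj₂ below)
    where
    below : Below i (W j)
    below k k≤i with W-cmp {k} {j} (<⇒≢ (ℕₚ.≤-<-trans k≤i i<j))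
    ... | inj₁ Wk<Wj = contradiction (k , k≤i , Wk<Wj) none
    ... | inj₂ Wj<Wk = Wj<Wk
  ...   | yes (l , j≤l , Wi<Wl) | yes (k , k≤i , Wk<Wj) = contradiction Wi<Wl
    (no1324-edge (≤∧≢⇒< k≤i k≢i) e (≤∧≢⇒< j≤l j≢l) Wk<Wj Wj<Wi)
    where
    k≢i : k ≢ i
    k≢i refl = ℕₚ.<-asym Wk<Wj Wj<Wi

    j≢l : j ≢ l
    j≢l refl = ℕₚ.<-asym Wj<Wi Wi<Wl

  -- The edges above and below are added on both sides rather than subtracted from the number of all
  -- edges.
  degree-w₀≤degree-w : degree w₀ ℕ.≤ degree w
  degree-w₀≤degree-w = ℕₚ.+-cancelʳ-≤ (∑above w₀ + ∑below w₀) _ _ (begin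
    degree w₀ + (∑above w₀ + ∑below w₀)
      ≡⟨ ∑²-distrib₃ (stays? w₀) (above? w₀) (below? w₀) ⟨
    ∑² (λ i j → 𝟙 (stays? w₀ i j) + (𝟙 (above? w₀ i j) + 𝟙 (below? w₀ i j)))
      ≤⟨ ∑²-mono-≤ (λ i j → 𝟙-partition-≤ (stays? w₀ i j) (edge? i j) (Above? j (w₀ {n} ‼ i)) (Below? i (w₀ {n} ‼ j)) stays-w₀) ⟩
    ∑² (λ i j → 𝟙 (edge? i j) + 𝟙 (both? w₀ w₀ i j))
      ≡⟨ ∑²-distrib-+ (λ i j → 𝟙 (edge? i j)) (λ i j → 𝟙 (both? w₀ w₀ i j)) ⟩
    ∑² (λ i j → 𝟙 (edge? i j)) + ∑² (λ i j → 𝟙 (both? w₀ w₀ i j))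
      ≤⟨ ℕₚ.+-monoʳ-≤ (∑² (λ i j → 𝟙 (edge? i j))) (ℕₚ.≤-trans (∑²-mono-columns both-columns) (∑-mono-≤ both-rows)) ⟩
    ∑² (λ i j → 𝟙 (edge? i j)) + ∑² (λ i j → 𝟙 (both? w w i j))
      ≡⟨ ∑²-distrib-+ (λ i j → 𝟙 (edge? i j)) (λ i j → 𝟙 (both? w w i j)) ⟨
    ∑² (λ i j → 𝟙 (edge? i j) + 𝟙 (both? w w i j))
      ≤⟨ ∑²-mono-≤ (λ i j → 𝟙-partition-≥ (stays? w i j) (edge? i j) (Above? j (W i)) (Below? i (W j)) edge-cases) ⟩
    ∑² (λ i j → 𝟙 (stays? w i j) + (𝟙 (above? w i j) + 𝟙 (below? w i j)))
      ≡⟨ ∑²-distrib₃ (stays? w) (above? w) (below? w) ⟩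
    degree w + (∑above w + ∑below w)
      ≤⟨ ℕₚ.+-monoʳ-≤ (degree w) (ℕₚ.+-mono-≤ (∑²-mono-columns above-≤) (∑-mono-≤ below-≤)) ⟩
    degree w + (∑above w₀ + ∑below w₀) ∎)
    where
    open ℕₚ.≤-Reasoning

    ∑above ∑below : Perm n → ℕ
    ∑above u = ∑² λ i j → 𝟙 (above? u i j)
    ∑below u = ∑² λ i j → 𝟙 (below? u i j)

    ∑²-distrib₃ : {P Q R : Fin n → Fin n → Set}
      (p? : ∀ i j → Dec (P i j)) (q? : ∀ i j → Dec (Q i j)) (r? : ∀ i j → Dec (R i j)) →
      ∑² (λ i j → 𝟙 (p? i j) + (𝟙 (q? i j) + 𝟙 (r? i j)))
        ≡ ∑² (λ i j → 𝟙 (p? i j)) + (∑² (λ i j → 𝟙 (q? i j)) + ∑² (λ i j → 𝟙 (r? i j)))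
    ∑²-distrib₃ p? q? r? = trans
      (∑²-distrib-+ (λ i j → 𝟙 (p? i j)) (λ i j → 𝟙 (q? i j) + 𝟙 (r? i j)))
      (cong (∑² (λ i j → 𝟙 (p? i j)) +_) (∑²-distrib-+ (λ i j → 𝟙 (q? i j)) (λ i j → 𝟙 (r? i j))))

  degree-constant : ∀ {u} → w ⪯ u → degree u ≡ degree w
  degree-constant {u} w⪯u = ℕₚ.≤-antisym
    (ℕₚ.≤-trans (degree-mono {u} (⪯⇒⊑ w⪯u) (⪯-w₀ (⪯-isPermutation w-perm w⪯u))) degree-w₀≤degree-w)
    (degree-mono {w} (λ x b → ℕₚ.≤-refl) w⪯u)

-- Counting neighbours and regularity

swap-injective : (u : Perm n) → IsPermutation u → ∀ {i j i′ j′} → i < j → i′ < j′ →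
  swap u i j ≡ swap u i′ j′ → i ≡ i′ × j ≡ j′
-- Reading both sides at `i` shows that the transposition of `i′` and `j′` sends `i` to `j`; as
-- `i < j`, this leaves `i ≡ i′`.
swap-injective u u-perm {i} {j} {i′} {j′} i<j i′<j′ eq = match (transposed i′ j′ i) refl
  (u-perm _ _ (trans (sym (swap-fst u i<j)) (trans (cong (_‼ i) eq) (lookup-swap u i′<j′ (transposed i′ j′ i)))))
  where
  match : ∀ {k k′} → Transposed i′ j′ k k′ → k ≡ i → j ≡ k′ → i ≡ i′ × j ≡ j′
  match at-p      refl refl = refl , refl
  match at-q      refl refl = contradiction i<j (ℕₚ.<-asym i′<j′)
  match (off _ _) refl refl = contradiction i<j (ℕₚ.<-irrefl refl)

module _ {n} (h : Fin n → Fin n) (h-hess : IsHessenberg h) (w : Perm n) (w-perm : IsPermutation w) where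

  open Degree h h-hess w

  hasSize-degree : ∀ u → w ⪯ u → HasSize (NeighbourIn h w u) (degree u)
  hasSize-degree u w⪯u = List.map flip pairs
    , trans (length-map flip pairs) (length-filter-cartesianProduct P? id id)
    , unique-map-on flip-injective (filter⁺ P? (cartesianProduct⁺ (allFin⁺ n) (allFin⁺ n)))
    , λ v → mk⇔ sound complete
    where
    u-perm : IsPermutation u
    u-perm = ⪯-isPermutation w-perm w⪯u

    flip : Fin n × Fin n → Perm n
    flip (i , j) = swap u i j

    P? : (p : Fin n × Fin n) → Dec (Stays u (proj₁ p) (proj₂ p))
    P? (i , j) = stays? u i j

    pairs : List (Fin n × Fin n)
    pairs = filter P? (cartesianProduct (List.allFin n) (List.allFin n))

    stays : ∀ {p} → p ∈ pairs → Stays u (proj₁ p) (proj₂ p)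
    stays p∈ = proj₂ (∈-filter⁻ P? {xs = cartesianProduct (List.allFin n) (List.allFin n)} p∈)

    flip-injective : ∀ {p q} → p ∈ pairs → q ∈ pairs → flip p ≡ flip q → p ≡ q
    flip-injective p∈ q∈ eq with swap-injective u u-perm (proj₁ (proj₁ (stays p∈))) (proj₁ (proj₁ (stays q∈))) eq
    ... | refl , refl = refl

    sound : ∀ {v} → v ∈ List.map flip pairs → NeighbourIn h w u v
    sound v∈ with ∈-map⁻ flip v∈
    ... | (i , j) , p∈ , refl with stays p∈
    ...   | (i<j , j≤hi) , w⊑ = (⊑⇒⪯ w-perm perm w⊑ , ⪯-w₀ perm) , i , j , i<j , j≤hi , refl
      where
      perm : IsPermutation (swap u i j)
      perm = swap-isPermutation u i<j u-perm

    complete : ∀ {v} → NeighbourIn h w u v → v ∈ List.map flip pairs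
    complete ((w⪯v , _) , i , j , i<j , j≤hi , refl) = ∈-map⁺ flip
      (∈-filter⁺ P? (∈-cartesianProduct⁺ (∈-allFin i) (∈-allFin j)) ((i<j , j≤hi) , ⪯⇒⊑ w⪯v))

theorem4p8 : (n : ℕ) (h : Fin n → Fin n) (w : Perm n) →
    IsHessenberg h → IsPermutation w → IsGenerator h w →
    ¬ Contains2143 h w → ¬ Contains1324 h w → ¬ Contains1243 h w →
    ¬ Contains2134 h w → ¬ Contains1423 h w → ¬ Contains2314 h w →
    ¬ Contains2413 h w →
    IsRegular h w
theorem4p8 n h w h-hess w-perm gen no2143 no1324 no1243 no2134 no1423 no2314 no2413 =
  degree w , λ u (w⪯u , _) → subst (HasSize (NeighbourIn h w u)) (degree-constant {u} w⪯u) (hasSize-degree h h-hess w w-perm u w⪯u)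
  where
  open Patterns h w h-hess w-perm gen no2143 no1324 no1243 no2134 no1423 no2314 no2413
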